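{- Let $n\geq 1$. Then in $\mathrm{NCSym}$ $$x_{\llbracket n\rrbracket}=(-1)^{n-1}\sum_{\sigma\vdash[n]}c_\sigma\, m_\sigma,$$ where $c_\sigma$ is the number of acyclic orientations of $K_\sigma$ with a unique sink at any fixed vertex (that is, for any choice of a vertex $v\in[n]$, $c_\sigma$ is the number of acyclic orientations of $K_\sigma$ whose unique sink is $v$).
   Context: A set partition $\pi\vdash[n]$ of $[n]=\{1,\dots,n\}$ is a collection of disjoint nonempty subsets (blocks) with union $[n]$; $\llbracket n\rrbracket$ is the set partition with the single block $[n]$. Set partitions of $[n]$ are ordered by refinement: $\sigma\le\pi$ if each block of $\sigma$ is contained in a block of $\pi$. $u$ is the Möbius function of this lattice: for $\sigma\le\pi$, $u(\sigma,\pi)=\prod_i(-1)^{k_i-1}(k_i-1)!$ where $k_i$ is the number of blocks of $\sigma$ contained in the $i$th block of $\pi$. In $\mathbb{Q}[[\mathbf{x}_1,\mathbf{x}_2,\dots]]$, noncommuting variables, for $\pi\vdash[n]$: $m_\pi=\sum\mathbf{x}_{i_1}\cdots\mathbf{x}_{i_n}$ over all tuples of positive integers $(i_1,\dots,i_n)$ with $i_j=i_k$ if and only if $j,k$ are in the same block of $\pi$; $p_\pi=\sum\mathbf{x}_{i_1}\cdots\mathbf{x}_{i_n}$ over all tuples with $i_j=i_k$ whenever $j,k$ are in the same block of $\pi$; and $x_\pi=\sum_{\sigma\le\pi}u(\sigma,\pi)\,p_\sigma$. $\mathrm{NCSym}$ is the algebra of symmetric functions in noncommuting variables, whose degree-$n$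 piece has each of $\{m_\pi\}_{\pi\vdash[n]}$, $\{p_\pi\}_{\pi\vdash[n]}$, $\{x_\pi\}_{\pi\vdash[n]}$ as a $\mathbb{Q}$-basis. For $\sigma\vdash[n]$, $K_\sigma$ is the complete multipartite graph on vertex set $[n]$ with an edge between $i$ and $j$ if and only if they lie in distinct blocks of $\sigma$. An acyclic orientation is an orientation of all edges with no directed cycle; a sink is a vertex with no outgoing edge (isolated vertices are sinks). -}

module Defs where

open import Data.Bool.Base using (if_then_else_)
import Data.Bool.Properties as Bool
open import Data.Empty using (⊥-elim)
open import Data.Fin.Base using (Fin; zero)
import Data.Fin.Properties as Fin
open import Data.Fin.Subset
  using (Subset; inside; outside; _∈_; _⊆_; _∩_; ⋃; ⊤; Nonempty; Empty)
open import Data.Fin.Subset.Properties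
  using (_∈?_; _⊆?_; nonempty?; ∪-identityʳ; ∈⊤; ∉⊥; x∈p∪q⁻)
open import Data.Integer.Base as ℤ using (ℤ; +_; -1ℤ; 1ℤ)
open import Data.List.Base as List
  using (List; []; _∷_; [_]; _++_; map; filter; mapMaybe; foldr; length;
         allFin; cartesianProductWith)
open import Data.List.Membership.Propositional using () renaming (_∈_ to _∈ˡ_)
open import Data.List.Membership.Propositional.Properties using (∈-allFin)
open import Data.List.Relation.Unary.All as All using (All; []; _∷_)
open import Data.List.Relation.Unary.AllPairs as AllPairs using (AllPairs; []; _∷_)
open import Data.List.Relation.Unary.Any as Any using (Any; here; there)
open import Data.Maybe.Base using (Maybe; just; nothing)
open import Data.Nat.Base using (ℕ; zero; suc; _∸_; NonZero; _!)
import Data.Nat.Properties as ℕ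
open import Data.Product.Base using (_×_; _,_; swap)
open import Data.Rational.Base as ℚ using (ℚ; 0ℚ; 1ℚ)
open import Data.Sum.Base using (_⊎_; inj₁; inj₂)
open import Data.Vec.Base as Vec using (Vec; []; _∷_; lookup; fromList; cast)
import Data.Vec.Properties as Vec
open import Function.Bundles using (_⇔_; mk⇔; Equivalence)
open import Level using (0ℓ)
open import Relation.Binary.Construct.Closure.Transitive as Plus
  using (TransClosure)
import Relation.Binary.Core as B
import Relation.Binary.Definitions as B
open import Relation.Binary.PropositionalEquality
  using (_≡_; refl; sym; subst)
open import Relation.Nullary.Decidable
  using (Dec; yes; no; does; map′; ¬?; _×-dec_; _⊎-dec_; _→-dec_; recompute)
open import Relation.Nullary.Negation using (¬_)
open import Relation.Unary using (Pred; Decidable)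

private
  variable
    n : ℕ

_⇔-dec_ : {P Q : Set} → Dec P → Dec Q → Dec (P ⇔ Q)
P? ⇔-dec Q? = map′ (λ (f , g) → mk⇔ f g)
                   (λ e → Equivalence.to e , Equivalence.from e)
                   ((P? →-dec Q?) ×-dec (Q? →-dec P?))

allVecs : {A : Set} → List A → ∀ n → List (Vec A n)
allVecs xs zero    = [ [] ]
allVecs xs (suc n) = cartesianProductWith _∷_ xs (allVecs xs n)

allSubsets : ∀ n → List (Subset n)
allSubsets = allVecs (outside ∷ inside ∷ [])

sublists : {A : Set} → List A → List (List A)
sublists []       = [ [] ]
sublists (x ∷ xs) = sublists xs ++ map (x ∷_) (sublists xs)

------------------------------------------------------------------------
-- Set partitions.  The set [n] is represented by Fin n.

Disjoint : B.Rel (Subset n) 0ℓ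
Disjoint A B = Empty (A ∩ B)

IsSetPartition : Pred (List (Subset n)) 0ℓ
IsSetPartition bs = All Nonempty bs × AllPairs Disjoint bs × ⋃ bs ≡ ⊤

isSetPartition? : Decidable (IsSetPartition {n})
isSetPartition? bs =
  All.all? nonempty? bs ×-dec
  AllPairs.allPairs? (λ A B → ¬? (nonempty? (A ∩ B))) bs ×-dec
  Vec.≡-dec Bool._≟_ (⋃ bs) ⊤

-- The order in which the blocks are listed carries no meaning.
record SetPartition (n : ℕ) : Set where
  constructor mkSetPartition
  field
    blocks          : List (Subset n)
    .isSetPartition : IsSetPartition blocks

open SetPartition public

toSetPartition : List (Subset n) → Maybe (SetPartition n)
toSetPartition bs with isSetPartition? bs
... | yes π = just (mkSetPartition bs π)
... | no  _ = nothing

-- Each set partition occurs exactly once here, with its blocks listed in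
-- the order in which they appear in allSubsets n.
setPartitions : ∀ n → List (SetPartition n)
setPartitions n = mapMaybe toSetPartition (sublists (allSubsets n))

⟦_⟧ : ∀ n .{{_ : NonZero n}} → SetPartition n
⟦ suc n ⟧ = mkSetPartition [ ⊤ ]
  (((zero , ∈⊤) ∷ []) , ([] ∷ []) , ∪-identityʳ ⊤)

SameBlock : SetPartition n → B.Rel (Fin n) 0ℓ
SameBlock π i j = Any (λ A → i ∈ A × j ∈ A) (blocks π)

sameBlock? : (π : SetPartition n) → B.Decidable (SameBlock π)
sameBlock? π i j = Any.any? (λ A → i ∈? A ×-dec j ∈? A) (blocks π)

infix 4 _≤_ _≤?_

_≤_ : B.Rel (SetPartition n) 0ℓ
σ ≤ π = All (λ A → Any (A ⊆_) (blocks π)) (blocks σ)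

_≤?_ : B.Decidable (_≤_ {n})
σ ≤? π = All.all? (λ A → Any.any? (A ⊆?_) (blocks π)) (blocks σ)

-- Only meaningful for σ ≤ π; then every k below is positive.
u : SetPartition n → SetPartition n → ℤ
u σ π = foldr ℤ._*_ 1ℤ (map factor (blocks π))
  where
  factor : Subset _ → ℤ
  factor A = let k = length (filter (_⊆? A) (blocks σ)) in
    -1ℤ ℤ.^ (k ∸ 1) ℤ.* + ((k ∸ 1) !)

------------------------------------------------------------------------
-- Formal power series in noncommuting variables over ℚ.  The word
-- i₁ ∷ … ∷ iₙ ∷ [] stands for the monomial 𝐱_{i₁+1} ⋯ 𝐱_{iₙ+1}, and a series
-- is given by its coefficients.

Word : Set
Word = List ℕ

Series : Set
Series = Word → ℚ

infix  4 _≋_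
infixl 6 _⊕_
infixr 7 _·_

_≋_ : B.Rel Series 0ℓ
f ≋ g = ∀ w → f w ≡ g w

_⊕_ : Series → Series → Series
(f ⊕ g) w = f w ℚ.+ g w

_·_ : ℚ → Series → Series
(a · f) w = a ℚ.* f w

𝟘 : Series
𝟘 w = 0ℚ

sumOver : {A : Set} → List A → (A → Series) → Series
sumOver xs f = foldr _⊕_ 𝟘 (map f xs)

infix 5 sumOver
syntax sumOver xs (λ a → f) = ∑[ a ← xs ] f

-- The formal sum of 𝐱_{i₁} ⋯ 𝐱_{iₙ} over all tuples (i₁,…,iₙ) satisfying P.
monomialSum : {P : Pred (Vec ℕ n) 0ℓ} → Decidable P → Series
monomialSum {n} P? w with length w ℕ.≟ n
... | yes |w|≡n = if does (P? (cast |w|≡n (fromList w))) then 1ℚ else 0ℚ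
... | no  _     = 0ℚ

MTuple PTuple : SetPartition n → Pred (Vec ℕ n) 0ℓ
MTuple π i = ∀ j k → lookup i j ≡ lookup i k ⇔ SameBlock π j k
PTuple π i = ∀ j k → SameBlock π j k → lookup i j ≡ lookup i k

mTuple? : (π : SetPartition n) → Decidable (MTuple π)
mTuple? π i = Fin.all? λ j → Fin.all? λ k →
  (lookup i j ℕ.≟ lookup i k) ⇔-dec sameBlock? π j k

pTuple? : (π : SetPartition n) → Decidable (PTuple π)
pTuple? π i = Fin.all? λ j → Fin.all? λ k →
  sameBlock? π j k →-dec (lookup i j ℕ.≟ lookup i k)

m : SetPartition n → Series
m π = monomialSum (mTuple? π)

p : SetPartition n → Series
p π = monomialSum (pTuple? π)

x : SetPartition n → Series
x {n} π = ∑[ σ ← filter (_≤? π) (setPartitions n) ] (u σ π ℚ./ 1) · p σ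

------------------------------------------------------------------------
-- Graphs on the vertex set [n]

record Graph (n : ℕ) : Set₁ where
  field
    Edge        : B.Rel (Fin n) 0ℓ
    edge?       : B.Decidable Edge
    symmetric   : B.Symmetric Edge
    irreflexive : ∀ i → ¬ Edge i i

∈⋃⁻ : ∀ {i} (bs : List (Subset n)) → i ∈ ⋃ bs → Any (i ∈_) bs
∈⋃⁻ []       i∈ = ⊥-elim (∉⊥ i∈)
∈⋃⁻ (A ∷ bs) i∈ with x∈p∪q⁻ A (⋃ bs) i∈
... | inj₁ i∈A = here i∈A
... | inj₂ i∈⋃ = there (∈⋃⁻ bs i∈⋃)

sameBlock-refl : (π : SetPartition n) → ∀ i → SameBlock π i i
sameBlock-refl (mkSetPartition bs π) i
  with _ , _ , ⋃≡⊤ ← recompute (isSetPartition? bs) π =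
  Any.map (λ i∈A → i∈A , i∈A) (∈⋃⁻ bs (subst (i ∈_) (sym ⋃≡⊤) ∈⊤))

K : SetPartition n → Graph n
K σ = record
  { Edge        = λ i j → ¬ SameBlock σ i j
  ; edge?       = λ i j → ¬? (sameBlock? σ i j)
  ; symmetric   = λ i≁j j∼i → i≁j (Any.map swap j∼i)
  ; irreflexive = λ i i≁i → i≁i (sameBlock-refl σ i)
  }

-- A digraph is given by the out-neighbourhoods of its vertices.
Digraph : ℕ → Set
Digraph n = Vec (Subset n) n

allDigraphs : ∀ n → List (Digraph n)
allDigraphs n = allVecs (allSubsets n) n

Arc : Digraph n → B.Rel (Fin n) 0ℓ
Arc D i j = j ∈ lookup D i

arc? : (D : Digraph n) → B.Decidable (Arc D)
arc? D i j = j ∈? lookup D i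

IsOrientation : Graph n → Pred (Digraph n) 0ℓ
IsOrientation G D = ∀ i j →
  (Arc D i j → Edge i j) ×
  (Edge i j → (Arc D i j × ¬ Arc D j i) ⊎ (¬ Arc D i j × Arc D j i))
  where open Graph G

isOrientation? : (G : Graph n) → Decidable (IsOrientation G)
isOrientation? G D = Fin.all? λ i → Fin.all? λ j →
  (arc? D i j →-dec edge? i j) ×-dec
  (edge? i j →-dec ((arc? D i j ×-dec ¬? (arc? D j i)) ⊎-dec
                    (¬? (arc? D i j) ×-dec arc? D j i)))
  where open Graph G

Acyclic : Pred (Digraph n) 0ℓ
Acyclic D = ∀ i → ¬ TransClosure (Arc D) i i

-- Warshall's algorithm: Via vs i j says that there is a nonempty walk from i
-- to j with all intermediate vertices in vs.
module _ {_∼_ : B.Rel (Fin n) 0ℓ} (_∼?_ : B.Decidable _∼_) where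

  Via : List (Fin n) → B.Rel (Fin n) 0ℓ
  Via []       i j = i ∼ j
  Via (v ∷ vs) i j = Via vs i j ⊎ (Via vs i v × Via vs v j)

  via? : ∀ vs → B.Decidable (Via vs)
  via? []       i j = i ∼? j
  via? (v ∷ vs) i j = via? vs i j ⊎-dec (via? vs i v ×-dec via? vs v j)

  via⇒⁺ : ∀ vs {i j} → Via vs i j → TransClosure _∼_ i j
  via⇒⁺ []       i∼j            = Plus.[ i∼j ]
  via⇒⁺ (v ∷ vs) (inj₁ ij)        = via⇒⁺ vs ij
  via⇒⁺ (v ∷ vs) (inj₂ (iv , vj)) = via⇒⁺ vs iv Plus.++ via⇒⁺ vs vj

  ∼⇒via : ∀ vs {i j} → i ∼ j → Via vs i j
  ∼⇒via []       i∼j = i∼j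
  ∼⇒via (v ∷ vs) i∼j = inj₁ (∼⇒via vs i∼j)

  via-trans : ∀ vs {i k j} → k ∈ˡ vs → Via vs i k → Via vs k j → Via vs i j
  via-trans (v ∷ vs) (here refl) ik kj = inj₂ (to-v ik , from-v kj)
    where
    to-v : ∀ {i} → Via (v ∷ vs) i v → Via vs i v
    to-v (inj₁ iv)       = iv
    to-v (inj₂ (iv , _)) = iv
    from-v : ∀ {j} → Via (v ∷ vs) v j → Via vs v j
    from-v (inj₁ vj)       = vj
    from-v (inj₂ (_ , vj)) = vj
  via-trans (v ∷ vs) (there k∈) (inj₁ ik) (inj₁ kj) =
    inj₁ (via-trans vs k∈ ik kj)
  via-trans (v ∷ vs) (there k∈) (inj₁ ik) (inj₂ (kv , vj)) =
    inj₂ (via-trans vs k∈ ik kv , vj)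
  via-trans (v ∷ vs) (there k∈) (inj₂ (iv , vk)) (inj₁ kj) =
    inj₂ (iv , via-trans vs k∈ vk kj)
  via-trans (v ∷ vs) (there k∈) (inj₂ (iv , _)) (inj₂ (_ , vj)) =
    inj₂ (iv , vj)

  ⁺⇒via : ∀ {i j} → TransClosure _∼_ i j → Via (allFin n) i j
  ⁺⇒via Plus.[ i∼j ]    = ∼⇒via (allFin n) i∼j
  ⁺⇒via (i∼k Plus.∷ kj) =
    via-trans (allFin n) (∈-allFin _) (∼⇒via (allFin n) i∼k) (⁺⇒via kj)

  transClosure? : B.Decidable (TransClosure _∼_)
  transClosure? i j = map′ (via⇒⁺ (allFin n)) ⁺⇒via (via? (allFin n) i j)

acyclic? : Decidable (Acyclic {n})
acyclic? D = Fin.all? λ i → ¬? (transClosure? (arc? D) i i)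

Sink : Digraph n → Pred (Fin n) 0ℓ
Sink D v = ∀ j → ¬ Arc D v j

sink? : (D : Digraph n) → Decidable (Sink D)
sink? D v = Fin.all? λ j → ¬? (arc? D v j)

UniqueSink : Digraph n → Pred (Fin n) 0ℓ
UniqueSink D v = Sink D v × (∀ w → Sink D w → w ≡ v)

uniqueSink? : (D : Digraph n) → Decidable (UniqueSink D)
uniqueSink? D v =
  sink? D v ×-dec Fin.all? (λ w → sink? D w →-dec (w Fin.≟ v))

AcyclicOrientationWithUniqueSink : Graph n → Fin n → Pred (Digraph n) 0ℓ
AcyclicOrientationWithUniqueSink G v D =
  IsOrientation G D × Acyclic D × UniqueSink D v

acyclicOrientationWithUniqueSink? :
  (G : Graph n) (v : Fin n) → Decidable (AcyclicOrientationWithUniqueSink G v)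
acyclicOrientationWithUniqueSink? G v D =
  isOrientation? G D ×-dec acyclic? D ×-dec uniqueSink? D v

c : SetPartition n → Fin n → ℕ
c {n} σ v =
  length (filter (acyclicOrientationWithUniqueSink? (K σ) v) (allDigraphs n))

{-# OPTIONS --safe #-}
-- For a graph G on [n], let H(S) be the sum of (−1)^k k! over the partitions of
-- S into k nonempty independent blocks, and a(S) the number of acyclic
-- orientations of G[S].  Removing one block of an ordered partition gives
--   Σ { H(S ─ B) | B ⊆ S independent } = [S = ∅],
-- and inclusion-exclusion over the set of sinks shows that (−1)^|S| a(S)
-- satisfies the same recursion, so the two agree.  Inclusion-exclusion with the
-- prescribed sink v then gives, for the number c of acyclic orientations with
-- unique sink v,
--   (−1)^(n−1) c = Σ { H([n] ─ B) | v ∈ B independent },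
-- and by the block containing v the right side is the sum of (−1)^(k−1) (k−1)!
-- over the partitions of [n] into k independent blocks, which does not mention v
-- (Greene-Zaslavsky).  The coefficient of a word w in x_⟦n⟧ is this sum for the
-- graph joining the positions of distinct letters of w, which is K σ for the only
-- σ such that w occurs in m_σ.
module Submission where

open import Defs
open import Data.Bool.Base using (Bool; true; false; if_then_else_)
import Data.Bool.Properties as Bool
open import Data.Empty using (⊥-elim)
open import Data.Fin.Base using (Fin; zero; suc)
open import Data.Fin.Induction using (spo-noetherian)
import Data.Fin.Properties as Fin
open import Data.Fin.Subset
  using (Subset; inside; outside; _∈_; _∉_; _⊆_; _─_; ⋃; ⊤; ⊥; _⊂_; ⁅_⁆; Nonempty; Empty)
open import Data.Fin.Subset.Induction using (⊂-wellFounded)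
open import Data.Fin.Subset.Properties
open import Data.Integer.Base using (ℤ; +_; -1ℤ; 0ℤ; 1ℤ; -_; _+_; _*_; _^_)
import Data.Integer.Properties as ℤ
open import Data.Integer.Tactic.RingSolver using (solve-∀)
open import Data.List.Base
  using (List; []; _∷_; _++_; map; filter; mapMaybe; length; cartesianProductWith)
import Data.List.Properties as List
open import Data.List.Membership.Propositional using () renaming (_∈_ to _∈ˡ_; find to ∈ˡ-find; lose to ∈ˡ-lose)
open import Data.List.Relation.Unary.All as All using (All; []; _∷_)
open import Data.List.Relation.Unary.AllPairs using (AllPairs; []; _∷_)
open import Data.List.Relation.Unary.Any using (here; there)
open import Data.Maybe.Base using (Maybe; just; nothing; maybe′)
open import Data.Nat.Base as ℕ using (ℕ; zero; suc; NonZero; _∸_; _!)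
import Data.Nat.Properties as ℕ
open import Data.Product.Base using (∃; _×_; _,_; proj₁; proj₂)
open import Data.Rational.Base as ℚ using (0ℚ; _/_)
import Data.Rational.Properties as ℚ
import Data.Rational.Unnormalised.Base as ℚᵘ
import Data.Rational.Unnormalised.Properties as ℚᵘ
open import Data.Sum.Base using (_⊎_; inj₁; inj₂)
open import Data.Vec.Base as Vec using (Vec; []; _∷_; lookup; fromList; cast)
import Data.Vec.Properties as Vec
open import Function.Base using (_∘_; case_of_)
open import Function.Bundles using (_⇔_; mk⇔; Equivalence)
open import Induction.WellFounded using (Acc; acc)
open import Relation.Binary.Construct.Closure.Transitive as Plus using (TransClosure)
open import Relation.Binary.Definitions using (DecidableEquality) renaming (Decidable to Decidable₂)
open import Relation.Binary.PropositionalEquality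
open import Relation.Binary.Structures using (IsStrictPartialOrder)
open import Relation.Nullary.Decidable
  using (Dec; yes; no; does; ¬?; _×-dec_; _⊎-dec_; _→-dec_; does-⇔; dec-true; dec-false; decidable-stable; recompute)
open import Relation.Nullary.Negation using (¬_; contradiction)
open import Relation.Unary using (Decidable)

open Equivalence using (to; from)
open ≡-Reasoning

private
  variable
    A B : Set
    P Q : Set
    n : ℕ

-- Integer indicators of decidable propositions.

𝟙 : Dec P → ℤ
𝟙 P? = if does P? then 1ℤ else 0ℤ

𝟙-yes : (P? : Dec P) → P → 𝟙 P? ≡ 1ℤ
𝟙-yes P? p = cong (if_then 1ℤ else 0ℤ) (dec-true P? p)

𝟙-no : (P? : Dec P) → ¬ P → 𝟙 P? ≡ 0ℤ
𝟙-no P? ¬p = cong (if_then 1ℤ else 0ℤ) (dec-false P? ¬p)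

𝟙-cong : (P? : Dec P) (Q? : Dec Q) → P ⇔ Q → 𝟙 P? ≡ 𝟙 Q?
𝟙-cong P? Q? P⇔Q = cong (if_then 1ℤ else 0ℤ) (does-⇔ P⇔Q P? Q?)

𝟙-× : (P? : Dec P) (Q? : Dec Q) → 𝟙 (P? ×-dec Q?) ≡ 𝟙 P? * 𝟙 Q?
𝟙-× P? Q? with does P? | does Q?
... | false | _     = refl
... | true  | false = refl
... | true  | true  = refl

𝟙-*-cong : (P? : Dec P) {a b : ℤ} → (P → a ≡ b) → 𝟙 P? * a ≡ 𝟙 P? * b
𝟙-*-cong (yes p) a≡b = cong (1ℤ *_) (a≡b p)
𝟙-*-cong (no _)  a≡b = refl

𝟙-no-* : (P? : Dec P) {a : ℤ} → ¬ P → 𝟙 P? * a ≡ 0ℤ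
𝟙-no-* P? {a} ¬p = cong (_* a) (𝟙-no P? ¬p)

𝟙-yes-* : (P? : Dec P) {a : ℤ} → P → 𝟙 P? * a ≡ a
𝟙-yes-* P? {a} p = trans (cong (_* a) (𝟙-yes P? p)) (ℤ.*-identityˡ a)

-- Finite integer sums over lists.

∑ : List A → (A → ℤ) → ℤ
∑ []       f = 0ℤ
∑ (x ∷ xs) f = f x + ∑ xs f

∑-cong : ∀ (xs : List A) {f g} → (∀ x → f x ≡ g x) → ∑ xs f ≡ ∑ xs g
∑-cong []       f≗g = refl
∑-cong (x ∷ xs) f≗g = cong₂ _+_ (f≗g x) (∑-cong xs f≗g)

∑-zero : ∀ (xs : List A) {f} → (∀ x → f x ≡ 0ℤ) → ∑ xs f ≡ 0ℤ
∑-zero []       f≗0 = refl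
∑-zero (x ∷ xs) f≗0 = cong₂ _+_ (f≗0 x) (∑-zero xs f≗0)

∑-+ : ∀ (xs : List A) f g → ∑ xs (λ x → f x + g x) ≡ ∑ xs f + ∑ xs g
∑-+ []       f g = refl
∑-+ (x ∷ xs) f g = begin
  f x + g x + ∑ xs (λ x → f x + g x)  ≡⟨ cong (_+_ (f x + g x)) (∑-+ xs f g) ⟩
  f x + g x + (∑ xs f + ∑ xs g)       ≡⟨ interchange (f x) (g x) (∑ xs f) (∑ xs g) ⟩
  f x + ∑ xs f + (g x + ∑ xs g)       ∎
  where
  interchange : ∀ a b c d → a + b + (c + d) ≡ a + c + (b + d)
  interchange = solve-∀

∑-*ˡ : ∀ (xs : List A) k f → ∑ xs (λ x → k * f x) ≡ k * ∑ xs f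
∑-*ˡ []       k f = sym (ℤ.*-zeroʳ k)
∑-*ˡ (x ∷ xs) k f =
  trans (cong (_+_ (k * f x)) (∑-*ˡ xs k f)) (sym (ℤ.*-distribˡ-+ k (f x) (∑ xs f)))

∑-swap : ∀ (xs : List A) (ys : List B) (f : A → B → ℤ) →
  ∑ xs (λ x → ∑ ys (f x)) ≡ ∑ ys (λ y → ∑ xs (λ x → f x y))
∑-swap []       ys f = sym (∑-zero ys (λ _ → refl))
∑-swap (x ∷ xs) ys f =
  trans (cong (_+_ (∑ ys (f x))) (∑-swap xs ys f))
        (sym (∑-+ ys (f x) (λ y → ∑ xs (λ x → f x y))))

∑-++ : ∀ (xs ys : List A) f → ∑ (xs ++ ys) f ≡ ∑ xs f + ∑ ys f
∑-++ []       ys f = sym (ℤ.+-identityˡ _)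
∑-++ (x ∷ xs) ys f =
  trans (cong (_+_ (f x)) (∑-++ xs ys f)) (sym (ℤ.+-assoc (f x) (∑ xs f) (∑ ys f)))

∑-map : ∀ (g : A → B) xs f → ∑ (map g xs) f ≡ ∑ xs (f ∘ g)
∑-map g []       f = refl
∑-map g (x ∷ xs) f = cong (_+_ (f (g x))) (∑-map g xs f)

∑-filter : ∀ {P : A → Set} (P? : Decidable P) xs f →
  ∑ (filter P? xs) f ≡ ∑ xs (λ x → 𝟙 (P? x) * f x)
∑-filter P? []       f = refl
∑-filter P? (x ∷ xs) f with does (P? x)
... | false = trans (∑-filter P? xs f) (sym (ℤ.+-identityˡ _))
... | true  = cong₂ _+_ (sym (ℤ.*-identityˡ (f x))) (∑-filter P? xs f)

length-filter-∑ : ∀ {P : A → Set} (P? : Decidable P) xs →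
  + length (filter P? xs) ≡ ∑ xs (𝟙 ∘ P?)
length-filter-∑ P? []       = refl
length-filter-∑ P? (x ∷ xs) with does (P? x)
... | false = trans (length-filter-∑ P? xs) (sym (ℤ.+-identityˡ _))
... | true  = cong (_+_ 1ℤ) (length-filter-∑ P? xs)

∑-mapMaybe : ∀ (g : A → Maybe B) xs f →
  ∑ (mapMaybe g xs) f ≡ ∑ xs (λ x → maybe′ f 0ℤ (g x))
∑-mapMaybe g []       f = refl
∑-mapMaybe g (x ∷ xs) f with g x
... | just y  = cong (_+_ (f y)) (∑-mapMaybe g xs f)
... | nothing = trans (∑-mapMaybe g xs f) (sym (ℤ.+-identityˡ _))

∑-cartesianProductWith : ∀ {C : Set} (g : A → B → C) xs ys f →
  ∑ (cartesianProductWith g xs ys) f ≡ ∑ xs (λ x → ∑ ys (λ y → f (g x y)))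
∑-cartesianProductWith g []       ys f = refl
∑-cartesianProductWith g (x ∷ xs) ys f = begin
  ∑ (map (g x) ys ++ cartesianProductWith g xs ys) f
    ≡⟨ ∑-++ (map (g x) ys) _ f ⟩
  ∑ (map (g x) ys) f + ∑ (cartesianProductWith g xs ys) f
    ≡⟨ cong₂ _+_ (∑-map (g x) ys f) (∑-cartesianProductWith g xs ys f) ⟩
  ∑ ys (f ∘ g x) + ∑ xs (λ x → ∑ ys (λ y → f (g x y))) ∎

-- Exhaustive lists without repetition, and sums along bijections.

-- Expresses that each `a` occurs exactly once in `xs`, as a sifting property that can be used
-- directly to collapse a sum.
Enumerates : DecidableEquality A → List A → Set
Enumerates {A} _≟_ xs = ∀ (a : A) (f : A → ℤ) → ∑ xs (λ x → 𝟙 (x ≟ a) * f x) ≡ f a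

-- The indicator of equality with `a ∷ as` factors into head and tail, so the double sum collapses
-- first over the tails, then over the heads.
allVecs-enumerates : ∀ {_≟_ : DecidableEquality A} {xs} →
  Enumerates _≟_ xs → ∀ n → Enumerates (Vec.≡-dec _≟_) (allVecs xs n)
allVecs-enumerates             enum zero    []       f =
  trans (ℤ.+-identityʳ _) (ℤ.*-identityˡ (f []))
allVecs-enumerates {_≟_ = _≟_} {xs} enum (suc n) (a ∷ as) f = begin
  ∑ (cartesianProductWith _∷_ xs (allVecs xs n)) (λ v → 𝟙 (v ≟ᵥ (a ∷ as)) * f v)
    ≡⟨ ∑-cartesianProductWith _∷_ xs (allVecs xs n) _ ⟩
  ∑ xs (λ x → ∑ (allVecs xs n) (λ v → 𝟙 ((x ∷ v) ≟ᵥ (a ∷ as)) * f (x ∷ v)))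
    ≡⟨ ∑-cong xs (λ x → trans
         (∑-cong (allVecs xs n) (λ v → trans (cong (_* f (x ∷ v)) (head-tail x v))
                                             (ℤ.*-assoc (𝟙 (x ≟ a)) _ _)))
         (trans (∑-*ˡ (allVecs xs n) (𝟙 (x ≟ a)) _)
                (cong (𝟙 (x ≟ a) *_) (allVecs-enumerates enum n as (f ∘ (x ∷_)))))) ⟩
  ∑ xs (λ x → 𝟙 (x ≟ a) * f (x ∷ as))
    ≡⟨ enum a (λ x → f (x ∷ as)) ⟩
  f (a ∷ as) ∎
  where
  _≟ᵥ_ : ∀ {n} → DecidableEquality (Vec _ n)
  _≟ᵥ_ = Vec.≡-dec _≟_
  head-tail : ∀ x v → 𝟙 ((x ∷ v) ≟ᵥ (a ∷ as)) ≡ 𝟙 (x ≟ a) * 𝟙 (v ≟ᵥ as)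
  head-tail x v = trans
    (𝟙-cong ((x ∷ v) ≟ᵥ (a ∷ as)) (x ≟ a ×-dec v ≟ᵥ as)
      (mk⇔ Vec.∷-injective (λ (x≡a , v≡as) → cong₂ _∷_ x≡a v≡as)))
    (𝟙-× (x ≟ a) (v ≟ᵥ as))

_≟ₛ_ : DecidableEquality (Subset n)
_≟ₛ_ = Vec.≡-dec Bool._≟_

_≟ᴰ_ : DecidableEquality (Digraph n)
_≟ᴰ_ = Vec.≡-dec _≟ₛ_

allSubsets-enumerates : ∀ n → Enumerates _≟ₛ_ (allSubsets n)
allSubsets-enumerates = allVecs-enumerates sides
  where
  sides : Enumerates Bool._≟_ (outside ∷ inside ∷ [])
  sides false f = trans (cong₂ _+_ (ℤ.*-identityˡ (f false)) refl) (ℤ.+-identityʳ _)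
  sides true  f = trans (ℤ.+-identityˡ _) (trans (ℤ.+-identityʳ _) (ℤ.*-identityˡ (f true)))

allDigraphs-enumerates : ∀ n → Enumerates _≟ᴰ_ (allDigraphs n)
allDigraphs-enumerates n = allVecs-enumerates (allSubsets-enumerates n) n

-- The hypothesis says that f and g restrict to mutually inverse bijections
-- between P and Q.
∑-bijection : ∀ {_≟_ : DecidableEquality A} {xs : List A} → Enumerates _≟_ xs →
  ∀ {P Q : A → Set} (P? : Decidable P) (Q? : Decidable Q) (f g : A → A) →
  (∀ x y → (P x × y ≡ f x) ⇔ (Q y × x ≡ g y)) →
  ∑ xs (𝟙 ∘ P?) ≡ ∑ xs (𝟙 ∘ Q?)
∑-bijection {_≟_ = _≟_} {xs} enum P? Q? f g inverse = begin
  ∑ xs (𝟙 ∘ P?)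
    -- Both sums become a sum over the pairs (x , y) in the graph of the bijection: the inserted
    -- indicator of `y ≟ f x` has total weight 1 over y.
    ≡⟨ ∑-cong xs (λ x → sym (enum (f x) (λ _ → 𝟙 (P? x)))) ⟩
  ∑ xs (λ x → ∑ xs (λ y → 𝟙 (y ≟ f x) * 𝟙 (P? x)))
    ≡⟨ ∑-swap xs xs _ ⟩
  ∑ xs (λ y → ∑ xs (λ x → 𝟙 (y ≟ f x) * 𝟙 (P? x)))
    ≡⟨ ∑-cong xs (λ y → ∑-cong xs (λ x → transport x y)) ⟩
  ∑ xs (λ y → ∑ xs (λ x → 𝟙 (x ≟ g y) * 𝟙 (Q? y)))
    ≡⟨ ∑-cong xs (λ y → enum (g y) (λ _ → 𝟙 (Q? y))) ⟩
  ∑ xs (𝟙 ∘ Q?) ∎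
  where
  transport : ∀ x y → 𝟙 (y ≟ f x) * 𝟙 (P? x) ≡ 𝟙 (x ≟ g y) * 𝟙 (Q? y)
  transport x y = begin
    𝟙 (y ≟ f x) * 𝟙 (P? x)    ≡⟨ ℤ.*-comm (𝟙 (y ≟ f x)) (𝟙 (P? x)) ⟩
    𝟙 (P? x) * 𝟙 (y ≟ f x)    ≡⟨ 𝟙-× (P? x) (y ≟ f x) ⟨
    𝟙 (P? x ×-dec y ≟ f x)    ≡⟨ 𝟙-cong (P? x ×-dec y ≟ f x) (Q? y ×-dec x ≟ g y) (inverse x y) ⟩
    𝟙 (Q? y ×-dec x ≟ g y)    ≡⟨ 𝟙-× (Q? y) (x ≟ g y) ⟩
    𝟙 (Q? y) * 𝟙 (x ≟ g y)    ≡⟨ ℤ.*-comm (𝟙 (Q? y)) (𝟙 (x ≟ g y)) ⟩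
    𝟙 (x ≟ g y) * 𝟙 (Q? y)    ∎

-- Subsets, their signs, and alternating sums over Boolean intervals.

subset : {P : Fin n → Set} → Decidable P → Subset n
subset P? = Vec.tabulate (does ∘ P?)

∈-subset : ∀ {P : Fin n → Set} (P? : Decidable P) {i} → i ∈ subset P? ⇔ P i
∈-subset P? {i} = mk⇔
  (λ i∈ → decidable-stable (P? i) λ ¬Pi → case
     trans (sym (Vec.[]=⇒lookup i∈)) (trans (Vec.lookup∘tabulate _ i) (dec-false (P? i) ¬Pi)) of λ ())
  (λ Pi → Vec.lookup⇒[]= i _ (trans (Vec.lookup∘tabulate _ i) (dec-true (P? i) Pi)))

x∈p─q⁻ : ∀ (S T : Subset n) {i} → i ∈ S ─ T → i ∈ S × i ∉ T
x∈p─q⁻ (inside ∷ S)  (outside ∷ T) Vec.here       = Vec.here , λ ()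
x∈p─q⁻ (outside ∷ S) (inside ∷ T)  {zero} ()
x∈p─q⁻ (outside ∷ S) (outside ∷ T) {zero} ()
x∈p─q⁻ (_ ∷ S)      (_ ∷ T)       (Vec.there i∈) with i∈S , i∉T ← x∈p─q⁻ S T i∈ =
  Vec.there i∈S , i∉T ∘ drop-there

-- The sign (-1)^|B|, by recursion on the membership vector so that inductions need no
-- cardinalities.
sgn : Subset n → ℤ
sgn []            = 1ℤ
sgn (outside ∷ B) = sgn B
sgn (inside ∷ B)  = - sgn B

-- Reflects |S| = |B| + |S ─ B|, which needs B inside S.
sgn-─ : ∀ (B S : Subset n) → B ⊆ S → sgn S ≡ sgn B * sgn (S ─ B)
sgn-─ []            []            B⊆S = refl
sgn-─ (outside ∷ B) (outside ∷ S) B⊆S = sgn-─ B S (drop-∷-⊆ B⊆S)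
sgn-─ (outside ∷ B) (inside ∷ S)  B⊆S =
  trans (cong -_ (sgn-─ B S (drop-∷-⊆ B⊆S))) (ℤ.neg-distribʳ-* (sgn B) (sgn (S ─ B)))
sgn-─ (inside ∷ B)  (outside ∷ S) B⊆S = contradiction (B⊆S Vec.here) λ ()
sgn-─ (inside ∷ B)  (inside ∷ S)  B⊆S =
  trans (cong -_ (sgn-─ B S (drop-∷-⊆ B⊆S))) (ℤ.neg-distribˡ-* (sgn B) (sgn (S ─ B)))

sgn-sgn : ∀ (B : Subset n) → sgn B * sgn B ≡ 1ℤ
sgn-sgn []            = refl
sgn-sgn (outside ∷ B) = sgn-sgn B
sgn-sgn (inside ∷ B)  = trans (neg-square (sgn B)) (sgn-sgn B)
  where
  neg-square : ∀ s → - s * - s ≡ s * s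
  neg-square = solve-∀

sgn-⊥ : ∀ n → sgn (⊥ {n}) ≡ 1ℤ
sgn-⊥ zero    = refl
sgn-⊥ (suc n) = sgn-⊥ n

sgn-⁅⁆ : ∀ (v : Fin n) → sgn ⁅ v ⁆ ≡ -1ℤ
sgn-⁅⁆ {suc n} zero    = cong -_ (sgn-⊥ n)
sgn-⁅⁆         (suc v) = sgn-⁅⁆ v

sgn-⊤ : ∀ n → sgn (⊤ {n}) ≡ -1ℤ ^ n
sgn-⊤ zero    = refl
sgn-⊤ (suc n) = trans (cong -_ (sgn-⊤ n)) (sym (ℤ.-1*i≡-i (-1ℤ ^ n)))

-- The core of inclusion-exclusion. A coordinate in T but not in R may be toggled in B, which pairs
-- off terms of opposite sign; a coordinate in R but not in T makes the interval empty. Only R = T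
-- leaves a term.
∑-interval : ∀ (R T : Subset n) →
  ∑ (allSubsets n) (λ B → 𝟙 (R ⊆? B) * (𝟙 (B ⊆? T) * sgn B)) ≡ 𝟙 (R ≟ₛ T) * sgn R
∑-interval []      []      = refl
∑-interval {suc n} (r ∷ R) (t ∷ T) =
  trans (∑-cartesianProductWith _∷_ (outside ∷ inside ∷ []) (allSubsets n) _) (split r t)
  where
  term : ∀ {n} → Subset n → Subset n → Subset n → ℤ
  term R T B = 𝟙 (R ⊆? B) * (𝟙 (B ⊆? T) * sgn B)

  interval : ∑ (allSubsets n) (term R T) ≡ 𝟙 (R ≟ₛ T) * sgn R
  interval = ∑-interval R T

  vanish : ∀ a k → a * (0ℤ * k) ≡ 0ℤ
  vanish a k = ℤ.*-zeroʳ a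

  negate : ∑ (allSubsets n) (λ B → 𝟙 (R ⊆? B) * (𝟙 (B ⊆? T) * - sgn B)) ≡
           -1ℤ * ∑ (allSubsets n) (term R T)
  negate = trans (∑-cong (allSubsets n) (λ B → pull (𝟙 (R ⊆? B)) (𝟙 (B ⊆? T)) (sgn B)))
                 (∑-*ˡ (allSubsets n) -1ℤ (term R T))
    where
    pull : ∀ a b c → a * (b * - c) ≡ -1ℤ * (a * (b * c))
    pull = solve-∀

  split : ∀ r t →
    ∑ (outside ∷ inside ∷ []) (λ s → ∑ (allSubsets n) (λ B → term (r ∷ R) (t ∷ T) (s ∷ B))) ≡
    𝟙 ((r ∷ R) ≟ₛ (t ∷ T)) * sgn (r ∷ R)
  split outside outside =
    trans (cong₂ _+_ interval (cong (_+ 0ℤ) (∑-zero (allSubsets n) (λ B → vanish (𝟙 (R ⊆? B)) (- sgn B)))))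
          (ℤ.+-identityʳ _)
  -- The free coordinate: the sums without it and with it are negatives of each other.
  split outside inside  =
    trans (cong (λ z → ∑ (allSubsets n) (term R T) + (z + 0ℤ)) negate) (cancel (∑ (allSubsets n) (term R T)))
    where
    cancel : ∀ a → a + (-1ℤ * a + 0ℤ) ≡ 0ℤ
    cancel = solve-∀
  split inside  outside =
    cong₂ _+_ (∑-zero (allSubsets n) (λ B → refl))
      (cong (_+ 0ℤ) (∑-zero (allSubsets n) (λ B → vanish (𝟙 (R ⊆? B)) (- sgn B))))
  split inside  inside  = begin
    ∑ (allSubsets n) _ + (∑ (allSubsets n) _ + 0ℤ)
      ≡⟨ cong₂ (λ a b → a + (b + 0ℤ)) (∑-zero (allSubsets n) (λ B → refl)) (trans negate (cong (_*_ -1ℤ) interval)) ⟩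
    0ℤ + (-1ℤ * (𝟙 (R ≟ₛ T) * sgn R) + 0ℤ)
      ≡⟨ rearrange (𝟙 (R ≟ₛ T)) (sgn R) ⟩
    𝟙 (R ≟ₛ T) * - sgn R ∎
    where
    rearrange : ∀ a b → 0ℤ + (-1ℤ * (a * b) + 0ℤ) ≡ a * - b
    rearrange = solve-∀

-- Weighted sums over the partitions of a set into admissible blocks.

module Tilings {n} {Ok : Subset n → Set} (ok? : Decidable Ok) where

  Fits : Subset n → Subset n → Set
  Fits S B = (Nonempty B × Ok B) × B ⊆ S

  fits? : ∀ S → Decidable (Fits S)
  fits? S B = (nonempty? B ×-dec ok? B) ×-dec B ⊆? S

  -- A partition of S into nonempty blocks satisfying `Ok`, described by what is left after each
  -- block is removed; disjointness and covering are built into the recursion.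
  Tiles : Subset n → List (Subset n) → Set
  Tiles S []       = Empty S
  Tiles S (B ∷ bs) = Fits S B × Tiles (S ─ B) bs

  tiles? : ∀ S → Decidable (Tiles S)
  tiles? S []       = ¬? (nonempty? S)
  tiles? S (B ∷ bs) = fits? S B ×-dec tiles? (S ─ B) bs

  -- L is arbitrary to allow induction on it. When L lists every subset once, each partition of S
  -- into admissible blocks is counted once, with its blocks in the order of L.
  tilingSum : List (Subset n) → Subset n → (List (Subset n) → ℤ) → ℤ
  tilingSum L S Φ = ∑ (sublists L) (λ bs → 𝟙 (tiles? S bs) * Φ bs)

  tilingSum-cong : ∀ L S {Φ Ψ} → (∀ bs → Tiles S bs → Φ bs ≡ Ψ bs) →
    tilingSum L S Φ ≡ tilingSum L S Ψ
  tilingSum-cong L S Φ≗Ψ = ∑-cong (sublists L) (λ bs → 𝟙-*-cong (tiles? S bs) (Φ≗Ψ bs))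

  tilingSum-*ˡ : ∀ L S k Φ → tilingSum L S (λ bs → k * Φ bs) ≡ k * tilingSum L S Φ
  tilingSum-*ˡ L S k Φ =
    trans (∑-cong (sublists L) (λ bs → exchange (𝟙 (tiles? S bs)) k (Φ bs)))
          (∑-*ˡ (sublists L) k (λ bs → 𝟙 (tiles? S bs) * Φ bs))
    where
    exchange : ∀ a b c → a * (b * c) ≡ b * (a * c)
    exchange = solve-∀

  tilingSum-+ : ∀ L S Φ Ψ →
    tilingSum L S (λ bs → Φ bs + Ψ bs) ≡ tilingSum L S Φ + tilingSum L S Ψ
  tilingSum-+ L S Φ Ψ =
    trans (∑-cong (sublists L) (λ bs → ℤ.*-distribˡ-+ (𝟙 (tiles? S bs)) (Φ bs) (Ψ bs)))
          (∑-+ (sublists L) (λ bs → 𝟙 (tiles? S bs) * Φ bs) (λ bs → 𝟙 (tiles? S bs) * Ψ bs))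

  -- A sublist of `B ∷ L` either leaves this B out or has it as its first block, which `Tiles` peels
  -- off first.
  tilingSum-∷ : ∀ B L S Φ →
    tilingSum (B ∷ L) S Φ ≡ tilingSum L S Φ + 𝟙 (fits? S B) * tilingSum L (S ─ B) (Φ ∘ (B ∷_))
  tilingSum-∷ B L S Φ = begin
    ∑ (sublists L ++ map (B ∷_) (sublists L)) φ
      ≡⟨ ∑-++ (sublists L) _ φ ⟩
    tilingSum L S Φ + ∑ (map (B ∷_) (sublists L)) φ
      ≡⟨ cong (_+_ (tilingSum L S Φ)) (∑-map (B ∷_) (sublists L) φ) ⟩
    tilingSum L S Φ + ∑ (sublists L) (λ bs → 𝟙 (fits? S B ×-dec tiles? (S ─ B) bs) * Φ (B ∷ bs))
      ≡⟨ cong (_+_ (tilingSum L S Φ)) (trans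
           (∑-cong (sublists L) (λ bs → trans
             (cong (_* Φ (B ∷ bs)) (𝟙-× (fits? S B) (tiles? (S ─ B) bs)))
             (ℤ.*-assoc (𝟙 (fits? S B)) _ _)))
           (∑-*ˡ (sublists L) (𝟙 (fits? S B)) _)) ⟩
    tilingSum L S Φ + 𝟙 (fits? S B) * tilingSum L (S ─ B) (Φ ∘ (B ∷_)) ∎
    where
    φ : List (Subset n) → ℤ
    φ bs = 𝟙 (tiles? S bs) * Φ bs

  tilingSum-empty : ∀ L {S} Φ → Empty S → tilingSum L S Φ ≡ Φ []
  tilingSum-empty []      {S} Φ S∅ = trans (ℤ.+-identityʳ _) (𝟙-yes-* (¬? (nonempty? S)) S∅)
  tilingSum-empty (B ∷ L) {S} Φ S∅ = begin
    tilingSum (B ∷ L) S Φ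
      ≡⟨ tilingSum-∷ B L S Φ ⟩
    tilingSum L S Φ + 𝟙 (fits? S B) * tilingSum L (S ─ B) (Φ ∘ (B ∷_))
      ≡⟨ cong₂ _+_ (tilingSum-empty L Φ S∅)
           (𝟙-no-* (fits? S B) λ (((i , i∈B) , _) , B⊆S) → S∅ (i , B⊆S i∈B)) ⟩
    Φ [] + 0ℤ
      ≡⟨ ℤ.+-identityʳ (Φ []) ⟩
    Φ [] ∎

  fits-self-─ : ∀ S B → ¬ Fits (S ─ B) B
  fits-self-─ S B (((_ , i∈B) , _) , B⊆) = proj₂ (x∈p─q⁻ S B (B⊆ i∈B)) i∈B

  -- Both products test the same symmetric condition: A and B are admissible, disjoint and contained
  -- in S.
  fits-exchange : ∀ S A B →
    𝟙 (fits? S B) * 𝟙 (fits? (S ─ B) A) ≡ 𝟙 (fits? S A) * 𝟙 (fits? (S ─ A) B)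
  fits-exchange S A B = begin
    𝟙 (fits? S B) * 𝟙 (fits? (S ─ B) A)   ≡⟨ 𝟙-× (fits? S B) (fits? (S ─ B) A) ⟨
    𝟙 (fits? S B ×-dec fits? (S ─ B) A)   ≡⟨ 𝟙-cong (fits? S B ×-dec fits? (S ─ B) A) (fits? S A ×-dec fits? (S ─ A) B)
                                               (mk⇔ (swap A B) (swap B A)) ⟩
    𝟙 (fits? S A ×-dec fits? (S ─ A) B)   ≡⟨ 𝟙-× (fits? S A) (fits? (S ─ A) B) ⟩
    𝟙 (fits? S A) * 𝟙 (fits? (S ─ A) B)   ∎
    where
    swap : ∀ A B → Fits S B × Fits (S ─ B) A → Fits S A × Fits (S ─ A) B
    swap A B ((okB , B⊆S) , (okA , A⊆S─B)) =
      (okA , λ i∈A → proj₁ (x∈p─q⁻ S B (A⊆S─B i∈A))) ,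
      (okB , λ i∈B → x∈p∧x∉q⇒x∈p─q (B⊆S i∈B) (λ i∈A → proj₂ (x∈p─q⁻ S B (A⊆S─B i∈A)) i∈B))

  -- The left side sums over tilings with a marked block B of weight ω B; the
  -- right side chooses B first and tiles its complement.
  tilingSum-mark : ∀ (ω : Subset n → ℤ) (F : ℕ → ℤ) L S →
    tilingSum L S (λ bs → ∑ bs ω * F (length bs)) ≡
    ∑ L (λ B → 𝟙 (fits? S B) * (ω B * tilingSum L (S ─ B) (F ∘ suc ∘ length)))
  tilingSum-mark ω F []      S =
    trans (ℤ.+-identityʳ _) (ℤ.*-zeroʳ (𝟙 (tiles? S [])))
  tilingSum-mark ω F (A ∷ L) S = begin
    tilingSum (A ∷ L) S (λ bs → ∑ bs ω * F (length bs))
      ≡⟨ tilingSum-∷ A L S _ ⟩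
    tilingSum L S (λ bs → ∑ bs ω * F (length bs)) +
    a * tilingSum L (S ─ A) (λ bs → (ω A + ∑ bs ω) * F (suc (length bs)))
      -- In a tiling that uses A, the marked block is A or one of the later blocks. The latter case
      -- is the induction hypothesis on `S ─ A`, with F shifted to account for A.
      ≡⟨ cong₂ (λ y z → y + a * z) (tilingSum-mark ω F L S) (trans
           (tilingSum-cong L (S ─ A) (λ bs _ → ℤ.*-distribʳ-+ (F (suc (length bs))) (ω A) (∑ bs ω)))
           (trans (tilingSum-+ L (S ─ A) (λ bs → ω A * F (suc (length bs)))
                                         (λ bs → ∑ bs ω * F (suc (length bs))))
             (cong₂ _+_ (tilingSum-*ˡ L (S ─ A) (ω A) (F ∘ suc ∘ length))
                        (tilingSum-mark ω (F ∘ suc) L (S ─ A))))) ⟩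
    ∑ L rest + a * (ω A * sA + ∑ L (λ B → 𝟙 (fits? (S ─ A) B) * (ω B * deep A B)))
      ≡⟨ rearrange (∑ L rest) a (ω A * sA) _ ⟩
    a * (ω A * sA) + (∑ L rest + a * ∑ L (λ B → 𝟙 (fits? (S ─ A) B) * (ω B * deep A B)))
      ≡⟨ cong₂ _+_ (cong (λ z → a * (ω A * z)) (sym first))
           (trans (cong (_+_ (∑ L rest)) (sym (∑-*ˡ L a _)))
             (trans (sym (∑-+ L rest _)) (∑-cong L others))) ⟩
    ∑ (A ∷ L) (λ B → 𝟙 (fits? S B) * (ω B * tilingSum (A ∷ L) (S ─ B) (F ∘ suc ∘ length))) ∎
    where
    a sA : ℤ
    a  = 𝟙 (fits? S A)
    sA = tilingSum L (S ─ A) (F ∘ suc ∘ length)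

    rest : Subset n → ℤ
    rest B = 𝟙 (fits? S B) * (ω B * tilingSum L (S ─ B) (F ∘ suc ∘ length))

    deep : Subset n → Subset n → ℤ
    deep A B = tilingSum L (S ─ A ─ B) (λ bs → F (suc (suc (length bs))))

    rearrange : ∀ r a s t → r + a * (s + t) ≡ a * s + (r + a * t)
    rearrange = solve-∀

    -- The nonempty block A does not fit into `S ─ A`, so its presence in the list adds no tilings.
    first : tilingSum (A ∷ L) (S ─ A) (F ∘ suc ∘ length) ≡ sA
    first = trans (tilingSum-∷ A L (S ─ A) _)
      (trans (cong (_+_ sA) (𝟙-no-* (fits? (S ─ A) A) (fits-self-─ S A))) (ℤ.+-identityʳ sA))

    -- For a marked B from L, the rest of the tiling avoids A or uses it; in the second case the
    -- order in which A and B are removed is exchanged.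
    others : ∀ B → rest B + a * (𝟙 (fits? (S ─ A) B) * (ω B * deep A B)) ≡
      𝟙 (fits? S B) * (ω B * tilingSum (A ∷ L) (S ─ B) (F ∘ suc ∘ length))
    others B = begin
      b * (ω B * sB) + a * (𝟙 (fits? (S ─ A) B) * (ω B * deep A B))
        ≡⟨ gather b (ω B) sB a (𝟙 (fits? (S ─ A) B)) (deep A B) ⟩
      ω B * (b * sB + a * 𝟙 (fits? (S ─ A) B) * deep A B)
        ≡⟨ cong₂ (λ y z → ω B * (b * sB + y * z)) (fits-exchange S B A)
             (cong (λ T → tilingSum L T (λ bs → F (suc (suc (length bs))))) (p─q─r≡p─r─q S A B)) ⟩
      ω B * (b * sB + b * 𝟙 (fits? (S ─ B) A) * deep B A)
        ≡⟨ spread b (ω B) sB (𝟙 (fits? (S ─ B) A)) (deep B A) ⟩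
      b * (ω B * (sB + 𝟙 (fits? (S ─ B) A) * deep B A))
        ≡⟨ cong (λ z → b * (ω B * z)) (tilingSum-∷ A L (S ─ B) _) ⟨
      b * (ω B * tilingSum (A ∷ L) (S ─ B) (F ∘ suc ∘ length)) ∎
      where
      b sB : ℤ
      b  = 𝟙 (fits? S B)
      sB = tilingSum L (S ─ B) (F ∘ suc ∘ length)
      gather : ∀ b w s a e d → b * (w * s) + a * (e * (w * d)) ≡ w * (b * s + a * e * d)
      gather = solve-∀
      spread : ∀ b w s e d → w * (b * s + b * e * d) ≡ b * (w * (s + e * d))
      spread = solve-∀

  tiles-miss : ∀ {v} S bs → Tiles S bs → v ∉ S → ∑ bs (λ B → 𝟙 (v ∈? B)) ≡ 0ℤ
  tiles-miss {v} S []       t v∉S = refl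
  tiles-miss {v} S (B ∷ bs) ((_ , B⊆S) , t) v∉S = cong₂ _+_
    (𝟙-no (v ∈? B) (λ v∈B → v∉S (B⊆S v∈B)))
    (tiles-miss (S ─ B) bs t (λ v∈S─B → v∉S (proj₁ (x∈p─q⁻ S B v∈S─B))))

  tiles-hit : ∀ {v} S bs → Tiles S bs → v ∈ S → ∑ bs (λ B → 𝟙 (v ∈? B)) ≡ 1ℤ
  tiles-hit {v} S []       S∅ v∈S = contradiction (v , v∈S) S∅
  tiles-hit {v} S (B ∷ bs) (_ , t) v∈S = case v ∈? B of λ where
    (yes v∈B) → cong₂ _+_ (𝟙-yes (v ∈? B) v∈B)
      (tiles-miss (S ─ B) bs t (λ v∈S─B → proj₂ (x∈p─q⁻ S B v∈S─B) v∈B))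
    (no v∉B)  → cong₂ _+_ (𝟙-no (v ∈? B) v∉B)
      (tiles-hit (S ─ B) bs t (x∈p∧x∉q⇒x∈p─q v∈S v∉B))

  -- Marks the block containing v: exactly one block of each tiling does, so the inserted weights
  -- sum to 1.
  tilingSum-by-element : ∀ (F : ℕ → ℤ) L {S v} → v ∈ S →
    tilingSum L S (F ∘ length) ≡
    ∑ L (λ B → 𝟙 (fits? S B) * (𝟙 (v ∈? B) * tilingSum L (S ─ B) (F ∘ suc ∘ length)))
  tilingSum-by-element F L {S} {v} v∈S =
    trans (tilingSum-cong L S (λ bs t → sym
            (trans (cong (_* F (length bs)) (tiles-hit S bs t v∈S)) (ℤ.*-identityˡ _))))
          (tilingSum-mark (λ B → 𝟙 (v ∈? B)) F L S)

  -- Marks an arbitrary block: the factor `length bs` counts the ways to do so.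
  tilingSum-by-block : ∀ (F : ℕ → ℤ) L S →
    tilingSum L S (λ bs → + length bs * F (length bs)) ≡
    ∑ L (λ B → 𝟙 (fits? S B) * tilingSum L (S ─ B) (F ∘ suc ∘ length))
  tilingSum-by-block F L S =
    trans (tilingSum-cong L S (λ bs _ → cong (_* F (length bs)) (length-∑ bs)))
      (trans (tilingSum-mark (λ _ → 1ℤ) F L S)
        (∑-cong L (λ B → cong (_*_ (𝟙 (fits? S B))) (ℤ.*-identityˡ _))))
    where
    length-∑ : ∀ (bs : List (Subset n)) → + length bs ≡ ∑ bs (λ _ → 1ℤ)
    length-∑ []       = refl
    length-∑ (_ ∷ bs) = cong (_+_ 1ℤ) (length-∑ bs)

-- The recursion for signed ordered partitions.

-- With the sign of the alternating sum; cyclicOrders is meaningful for k ≥ 1 only.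
linearOrders cyclicOrders : ℕ → ℤ
linearOrders k = -1ℤ ^ k * + (k !)
cyclicOrders k = -1ℤ ^ (k ∸ 1) * + ((k ∸ 1) !)

-- Here `cyclicOrders (suc k)` unfolds to `linearOrders k`. The factor `suc k` that is split off is
-- what `tilingSum-by-block` turns into the choice of a block, after which the weight `linearOrders`
-- is back.
linearOrders-suc : ∀ k → linearOrders (suc k) ≡ -1ℤ * (+ suc k * cyclicOrders (suc k))
linearOrders-suc k =
  trans (cong (_*_ (-1ℤ ^ suc k)) (ℤ.pos-* (suc k) (k !))) (rearrange (-1ℤ ^ k) (+ suc k) (+ (k !)))
  where
  rearrange : ∀ s a b → -1ℤ * s * (a * b) ≡ -1ℤ * (a * (s * b))
  rearrange = solve-∀

module _ {n} {Ok : Subset n → Set} (ok? : Decidable Ok) where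
  open Tilings ok?

  -- A tiling of a nonempty S has a block, so `linearOrders-suc` applies and one block can be
  -- removed. For empty S no block fits and only the empty tiling remains.
  orderedTilings-rec : ∀ L S → tilingSum L S (linearOrders ∘ length) ≡
    𝟙 (¬? (nonempty? S)) +
    -1ℤ * ∑ L (λ B → 𝟙 (fits? S B) * tilingSum L (S ─ B) (linearOrders ∘ length))
  orderedTilings-rec L S = by-cases (nonempty? S)
    where
    rest : ℤ
    rest = ∑ L (λ B → 𝟙 (fits? S B) * tilingSum L (S ─ B) (linearOrders ∘ length))

    nonempty-tiles : ∀ {i} → i ∈ S → ∀ bs → Tiles S bs →
      linearOrders (length bs) ≡ -1ℤ * (+ length bs * cyclicOrders (length bs))
    nonempty-tiles i∈S []       S∅ = contradiction (_ , i∈S) S∅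
    nonempty-tiles i∈S (B ∷ bs) _  = linearOrders-suc (length bs)

    by-cases : Dec (Nonempty S) →
      tilingSum L S (linearOrders ∘ length) ≡ 𝟙 (¬? (nonempty? S)) + -1ℤ * rest
    by-cases (yes S≢∅@(i , i∈S)) = begin
      tilingSum L S (linearOrders ∘ length)
        ≡⟨ tilingSum-cong L S (nonempty-tiles i∈S) ⟩
      tilingSum L S (λ bs → -1ℤ * (+ length bs * cyclicOrders (length bs)))
        ≡⟨ tilingSum-*ˡ L S -1ℤ _ ⟩
      -1ℤ * tilingSum L S (λ bs → + length bs * cyclicOrders (length bs))
        ≡⟨ cong (_*_ -1ℤ) (tilingSum-by-block cyclicOrders L S) ⟩
      -1ℤ * rest
        ≡⟨ ℤ.+-identityˡ _ ⟨
      0ℤ + -1ℤ * rest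
        ≡⟨ cong (_+ -1ℤ * rest) (𝟙-no (¬? (nonempty? S)) (λ S∅ → S∅ S≢∅)) ⟨
      𝟙 (¬? (nonempty? S)) + -1ℤ * rest ∎
    by-cases (no S∅) = begin
      tilingSum L S (linearOrders ∘ length)
        ≡⟨ tilingSum-empty L _ S∅ ⟩
      1ℤ + -1ℤ * 0ℤ
        ≡⟨ cong₂ (λ a b → a + -1ℤ * b) (𝟙-yes (¬? (nonempty? S)) S∅)
             (∑-zero L (λ B → 𝟙-no-* (fits? S B) (λ (((i , i∈B) , _) , B⊆S) → S∅ (i , B⊆S i∈B)))) ⟨
      𝟙 (¬? (nonempty? S)) + -1ℤ * rest ∎

  -- Blocks that fit are nonempty, so the recursion only calls f on strictly smaller sets and
  -- determines it by well-founded induction.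
  orderedTilings-unique : ∀ L (f : Subset n → ℤ) →
    (∀ S → f S ≡ 𝟙 (¬? (nonempty? S)) + -1ℤ * ∑ L (λ B → 𝟙 (fits? S B) * f (S ─ B))) →
    ∀ S → f S ≡ tilingSum L S (linearOrders ∘ length)
  orderedTilings-unique L f f-rec S = go S (⊂-wellFounded S)
    where
    go : ∀ S → Acc _⊂_ S → f S ≡ tilingSum L S (linearOrders ∘ length)
    go S (acc rec) = begin
      f S
        ≡⟨ f-rec S ⟩
      𝟙 (¬? (nonempty? S)) + -1ℤ * ∑ L (λ B → 𝟙 (fits? S B) * f (S ─ B))
        ≡⟨ cong (λ z → 𝟙 (¬? (nonempty? S)) + -1ℤ * z) (∑-cong L (λ B → 𝟙-*-cong (fits? S B)
             (λ (((i , i∈B) , _) , B⊆S) → go (S ─ B)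
               (rec (p∩q≢∅⇒p─q⊂p S B (i , x∈p∩q⁺ (B⊆S i∈B , i∈B))))))) ⟩
      𝟙 (¬? (nonempty? S)) + -1ℤ * ∑ L (λ B → 𝟙 (fits? S B) * tilingSum L (S ─ B) (linearOrders ∘ length))
        ≡⟨ orderedTilings-rec L S ⟨
      tilingSum L S (linearOrders ∘ length) ∎

-- Digraphs from decidable relations, and sinks of acyclic digraphs.

digraph : {R : Fin n → Fin n → Set} → Decidable₂ R → Digraph n
digraph R? = Vec.tabulate (λ i → subset (R? i))

arc-digraph : ∀ {R : Fin n → Fin n → Set} (R? : Decidable₂ R) {i j} → Arc (digraph R?) i j ⇔ R i j
arc-digraph R? {i} {j} rewrite Vec.lookup∘tabulate (λ i → subset (R? i)) i = ∈-subset (R? i)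

digraph-ext : ∀ {D E : Digraph n} → (∀ i j → Arc D i j ⇔ Arc E i j) → D ≡ E
digraph-ext {D = D} {E} D⇔E = begin
  D                       ≡⟨ Vec.tabulate∘lookup D ⟨
  Vec.tabulate (lookup D) ≡⟨ Vec.tabulate-cong (λ i → ⊆-antisym (λ {j} → to (D⇔E i j)) (λ {j} → from (D⇔E i j))) ⟩
  Vec.tabulate (lookup E) ≡⟨ Vec.tabulate∘lookup E ⟩
  E                       ∎

-- Acyclicity makes reachability a strict partial order, which is noetherian on a finite set:
-- following arcs from i never leaves P and has to stop, at a sink.
acyclic⇒sink : ∀ (D : Digraph n) → Acyclic D → ∀ {P : Fin n → Set} →
  (∀ {i j} → P i → Arc D i j → P j) → ∀ {i} → P i → ∃ λ v → P v × Sink D v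
acyclic⇒sink D acyclic {P} closed {i} = go i (spo-noetherian isStrictPartialOrder i)
  where
  isStrictPartialOrder : IsStrictPartialOrder _≡_ (TransClosure (Arc D))
  isStrictPartialOrder = record
    { isEquivalence = isEquivalence
    ; irrefl        = λ { refl → acyclic _ }
    ; trans         = Plus._++_
    ; <-resp-≈      = resp₂ (TransClosure (Arc D))
    }

  go : ∀ i → Acc (λ j i → TransClosure (Arc D) i j) i → P i → ∃ λ v → P v × Sink D v
  go i (acc rec) Pi with Fin.any? (arc? D i)
  ... | yes (j , i→j) = go j (rec Plus.[ i→j ]) (closed Pi i→j)
  ... | no  ¬i→       = i , Pi , λ j i→j → ¬i→ (j , i→j)

-- Acyclic orientations of induced subgraphs, sorted by their sinks.

module Orientations {n} (G : Graph n) where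
  open Graph G

  Independent : Subset n → Set
  Independent B = ∀ i j → i ∈ B → j ∈ B → ¬ Edge i j

  independent? : Decidable Independent
  independent? B = Fin.all? λ i → Fin.all? λ j → i ∈? B →-dec (j ∈? B →-dec ¬? (edge? i j))

  -- Vertices outside S stay as isolated vertices, so that the orientations for all S are digraphs
  -- of one type.
  induced : Subset n → Graph n
  induced S = record
    { Edge        = λ i j → Edge i j × i ∈ S × j ∈ S
    ; edge?       = λ i j → edge? i j ×-dec i ∈? S ×-dec j ∈? S
    ; symmetric   = λ (e , i∈S , j∈S) → symmetric e , j∈S , i∈S
    ; irreflexive = λ i (e , _) → irreflexive i e
    }

  Orients : Subset n → Digraph n → Set
  Orients S D = IsOrientation (induced S) D × Acyclic D

  orients? : ∀ S → Decidable (Orients S)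
  orients? S D = isOrientation? (induced S) D ×-dec acyclic? D

  acyclicOrientations : Subset n → ℤ
  acyclicOrientations S = ∑ (allDigraphs n) (λ D → 𝟙 (orients? S D))

  -- Restricted to S because in an orientation of `induced S` every vertex outside S is isolated,
  -- hence a sink.
  sinks : Subset n → Digraph n → Subset n
  sinks S D = subset (λ i → i ∈? S ×-dec sink? D i)

  ∈-sinks : ∀ S D {i} → i ∈ sinks S D ⇔ (i ∈ S × Sink D i)
  ∈-sinks S D = ∈-subset (λ i → i ∈? S ×-dec sink? D i)

  arc-within : ∀ S D {i j} → Orients S D → Arc D i j → i ∈ S × j ∈ S
  arc-within S D (orient , _) i→j = proj₂ (proj₁ (orient _ _) i→j)

  module _ (S B : Subset n) (B⊆S : B ⊆ S) (independent : Independent B) where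

    -- Orientations of G[S ─ B] correspond to orientations of G[S] in which B
    -- consists of sinks, since every edge meeting B must then point into B.
    DetachedArc AttachedArc : Digraph n → Fin n → Fin n → Set
    DetachedArc D i j = Arc D i j × j ∉ B
    AttachedArc D i j = Arc D i j ⊎ (Edge i j × i ∈ S × j ∈ B)

    detachedArc? : ∀ D → Decidable₂ (DetachedArc D)
    detachedArc? D i j = arc? D i j ×-dec ¬? (j ∈? B)

    attachedArc? : ∀ D → Decidable₂ (AttachedArc D)
    attachedArc? D i j = arc? D i j ⊎-dec edge? i j ×-dec i ∈? S ×-dec j ∈? B

    detach attach : Digraph n → Digraph n
    detach D = digraph (detachedArc? D)
    attach D = digraph (attachedArc? D)

    module _ D (orients : Orients (S ─ B) D) where

      private
        orient : IsOrientation (induced (S ─ B)) D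
        orient = proj₁ orients

      arc⁺ : ∀ {i j} → AttachedArc D i j → Arc (attach D) i j
      arc⁺ = from (arc-digraph (attachedArc? D))

      arc⁻ : ∀ {i j} → Arc (attach D) i j → AttachedArc D i j
      arc⁻ = to (arc-digraph (attachedArc? D))

      attach-sink : ∀ {i} → i ∈ B → Sink (attach D) i
      attach-sink i∈B j i→j with arc⁻ i→j
      ... | inj₁ i→j            = proj₂ (x∈p─q⁻ S B (proj₁ (arc-within (S ─ B) D orients i→j))) i∈B
      ... | inj₂ (e , _ , j∈B)  = independent _ _ i∈B j∈B e

      attach-orientation : IsOrientation (induced S) (attach D)
      attach-orientation i j = edge , orientation
        where
        edge : Arc (attach D) i j → Edge i j × i ∈ S × j ∈ S
        edge i→j with arc⁻ i→j
        ... | inj₂ (e , i∈S , j∈B) = e , i∈S , B⊆S j∈B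
        ... | inj₁ i→j with e , i∈ , j∈ ← proj₁ (orient i j) i→j =
          e , proj₁ (x∈p─q⁻ S B i∈) , proj₁ (x∈p─q⁻ S B j∈)

        orientation : Edge i j × i ∈ S × j ∈ S →
          (Arc (attach D) i j × ¬ Arc (attach D) j i) ⊎ (¬ Arc (attach D) i j × Arc (attach D) j i)
        orientation (e , i∈S , j∈S) with i ∈? B | j ∈? B
        ... | _       | yes j∈B = inj₁ (arc⁺ (inj₂ (e , i∈S , j∈B)) , attach-sink j∈B i)
        ... | yes i∈B | no _    = inj₂ (attach-sink i∈B j , arc⁺ (inj₂ (symmetric e , j∈S , i∈B)))
        ... | no i∉B  | no j∉B
          with proj₂ (orient i j) (e , x∈p∧x∉q⇒x∈p─q i∈S i∉B , x∈p∧x∉q⇒x∈p─q j∈S j∉B)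
        ...   | inj₁ (i→j , ¬j→i) = inj₁ (arc⁺ (inj₁ i→j) , λ j→i → case arc⁻ j→i of λ where
                  (inj₁ j→i) → ¬j→i j→i
                  (inj₂ (_ , _ , i∈B)) → i∉B i∈B)
        ...   | inj₂ (¬i→j , j→i) = inj₂ ((λ i→j → case arc⁻ i→j of λ where
                  (inj₁ i→j) → ¬i→j i→j
                  (inj₂ (_ , _ , j∈B)) → j∉B j∈B) , arc⁺ (inj₁ j→i))

      no-walk-from-B : ∀ {i j} → i ∈ B → ¬ TransClosure (Arc (attach D)) i j
      no-walk-from-B i∈B Plus.[ i→j ]   = attach-sink i∈B _ i→j
      no-walk-from-B i∈B (i→k Plus.∷ _) = attach-sink i∈B _ i→k

      -- A walk that enters B stops there, since B consists of sinks; one that ends outside B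
      -- therefore uses only arcs of D.
      attach-walk : ∀ {i j} → TransClosure (Arc (attach D)) i j → j ∉ B → TransClosure (Arc D) i j
      attach-walk Plus.[ i→j ] j∉B with arc⁻ i→j
      ... | inj₁ i→j           = Plus.[ i→j ]
      ... | inj₂ (_ , _ , j∈B) = contradiction j∈B j∉B
      attach-walk (i→k Plus.∷ k→j) j∉B with arc⁻ i→k
      ... | inj₁ i→k           = i→k Plus.∷ attach-walk k→j j∉B
      ... | inj₂ (_ , _ , k∈B) = contradiction k→j (no-walk-from-B k∈B)

      attach-acyclic : Acyclic (attach D)
      attach-acyclic i i→i = proj₂ orients i (attach-walk i→i (λ i∈B → no-walk-from-B i∈B i→i))

      detach-attach : D ≡ detach (attach D)
      detach-attach = digraph-ext λ i j → mk⇔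
        (λ i→j → from (arc-digraph (detachedArc? (attach D)))
          (arc⁺ (inj₁ i→j) , proj₂ (x∈p─q⁻ S B (proj₂ (arc-within (S ─ B) D orients i→j)))))
        (λ i→j → case to (arc-digraph (detachedArc? (attach D))) i→j of λ (a , j∉B) → case arc⁻ a of λ where
          (inj₁ i→j)           → i→j
          (inj₂ (_ , _ , j∈B)) → contradiction j∈B j∉B)

    module _ D (orients : Orients S D) (sink : B ⊆ sinks S D) where

      private
        orient : IsOrientation (induced S) D
        orient = proj₁ orients

      B-sink : ∀ {i} → i ∈ B → Sink D i
      B-sink i∈B = proj₂ (to (∈-sinks S D) (sink i∈B))

      detach-arc⁻ : ∀ {i j} → Arc (detach D) i j → Arc D i j × j ∉ B
      detach-arc⁻ = to (arc-digraph (detachedArc? D))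

      detach-arc⁺ : ∀ {i j} → Arc D i j × j ∉ B → Arc (detach D) i j
      detach-arc⁺ = from (arc-digraph (detachedArc? D))

      detach-orients : Orients (S ─ B) (detach D)
      detach-orients = (λ i j → edge , orientation) ,
        λ i i→i → proj₂ orients i (walk i→i)
        where
        walk : ∀ {i j} → TransClosure (Arc (detach D)) i j → TransClosure (Arc D) i j
        walk Plus.[ i→j ]     = Plus.[ proj₁ (detach-arc⁻ i→j) ]
        walk (i→k Plus.∷ k→j) = proj₁ (detach-arc⁻ i→k) Plus.∷ walk k→j

        edge : ∀ {i j} → Arc (detach D) i j → Edge i j × i ∈ S ─ B × j ∈ S ─ B
        edge {i} {j} a with i→j , j∉B ← detach-arc⁻ a | e , i∈S , j∈S ← proj₁ (orient i j) (proj₁ (detach-arc⁻ a)) =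
          e , x∈p∧x∉q⇒x∈p─q i∈S (λ i∈B → B-sink i∈B j i→j) , x∈p∧x∉q⇒x∈p─q j∈S j∉B

        orientation : ∀ {i j} → Edge i j × i ∈ S ─ B × j ∈ S ─ B →
          (Arc (detach D) i j × ¬ Arc (detach D) j i) ⊎ (¬ Arc (detach D) i j × Arc (detach D) j i)
        orientation {i} {j} (e , i∈ , j∈)
          with i∈S , i∉B ← x∈p─q⁻ S B i∈ | j∈S , j∉B ← x∈p─q⁻ S B j∈
          with proj₂ (orient i j) (e , i∈S , j∈S)
        ... | inj₁ (i→j , ¬j→i) = inj₁ (detach-arc⁺ (i→j , j∉B) , ¬j→i ∘ proj₁ ∘ detach-arc⁻)
        ... | inj₂ (¬i→j , j→i) = inj₂ (¬i→j ∘ proj₁ ∘ detach-arc⁻ , detach-arc⁺ (j→i , i∉B))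

      attach-detach : D ≡ attach (detach D)
      attach-detach = digraph-ext λ i j → mk⇔
        (λ i→j → from (arc-digraph (attachedArc? (detach D))) (case j ∈? B of λ where
          (yes j∈B) → case proj₁ (orient i j) i→j of λ (e , i∈S , _) → inj₂ (e , i∈S , j∈B)
          (no  j∉B) → inj₁ (detach-arc⁺ (i→j , j∉B))))
        (λ a → case to (arc-digraph (attachedArc? (detach D))) a of λ where
          (inj₁ i→j)             → proj₁ (detach-arc⁻ i→j)
          (inj₂ (e , i∈S , j∈B)) → case proj₂ (orient i j) (e , i∈S , B⊆S j∈B) of λ where
            (inj₁ (i→j , _)) → i→j
            (inj₂ (_ , j→i)) → contradiction j→i (B-sink j∈B i))

    acyclicOrientations-─ : acyclicOrientations (S ─ B) ≡
      ∑ (allDigraphs n) (λ D → 𝟙 (orients? S D ×-dec B ⊆? sinks S D))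
    acyclicOrientations-─ = ∑-bijection {_≟_ = _≟ᴰ_} {allDigraphs n} (allDigraphs-enumerates n)
      (orients? (S ─ B)) (λ D → orients? S D ×-dec B ⊆? sinks S D) attach detach
      (λ D E → mk⇔
        (λ where (orients , refl) →
                   ((attach-orientation D orients , attach-acyclic D orients) ,
                    λ i∈B → from (∈-sinks S (attach D)) (B⊆S i∈B , attach-sink D orients i∈B)) ,
                   detach-attach D orients)
        (λ where ((orients , sink) , refl) → detach-orients E orients sink , attach-detach E orients sink))

  -- Each edge of G[S] leaves one of its ends, so sinks in S are pairwise non-adjacent, and a B that
  -- fails the guard lies in no `sinks S D`. For every other B the bijection of `attach` and
  -- `detach` applies.
  acyclicOrientations-sinks : ∀ S B →
    𝟙 (independent? B ×-dec B ⊆? S) * acyclicOrientations (S ─ B) ≡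
    ∑ (allDigraphs n) (λ D → 𝟙 (orients? S D) * 𝟙 (B ⊆? sinks S D))
  acyclicOrientations-sinks S B = trans (by-cases (independent? B ×-dec B ⊆? S))
    (∑-cong (allDigraphs n) (λ D → 𝟙-× (orients? S D) (B ⊆? sinks S D)))
    where
    by-cases : ∀ (d : Dec (Independent B × B ⊆ S)) → 𝟙 d * acyclicOrientations (S ─ B) ≡
      ∑ (allDigraphs n) (λ D → 𝟙 (orients? S D ×-dec B ⊆? sinks S D))
    by-cases (yes (independent , B⊆S)) =
      trans (ℤ.*-identityˡ _) (acyclicOrientations-─ S B B⊆S independent)
    by-cases (no ¬p) = sym (∑-zero (allDigraphs n) (λ D → 𝟙-no (orients? S D ×-dec B ⊆? sinks S D)
      λ ((orient , _) , B⊆) → ¬p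
        ( (λ i j i∈B j∈B e → case (to (∈-sinks S D) (B⊆ i∈B) , to (∈-sinks S D) (B⊆ j∈B)) of
             λ ((i∈S , sinkᵢ) , (j∈S , sinkⱼ)) → case proj₂ (orient i j) (e , i∈S , j∈S) of λ where
               (inj₁ (i→j , _)) → sinkᵢ j i→j
               (inj₂ (_ , j→i)) → sinkⱼ i j→i)
        , λ i∈B → proj₁ (to (∈-sinks S D) (B⊆ i∈B)))))

  -- The inclusion-exclusion step: the sum counts the orientations D of G[S] with
  -- the signed sets B of sinks of D that contain R, which cancel unless R consists
  -- of all the sinks.
  ∑-peel : ∀ R S →
    ∑ (allSubsets n) (λ B → 𝟙 (R ⊆? B) * (𝟙 (independent? B ×-dec B ⊆? S) * (sgn B * acyclicOrientations (S ─ B)))) ≡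
    sgn R * ∑ (allDigraphs n) (λ D → 𝟙 (orients? S D ×-dec R ≟ₛ sinks S D))
  ∑-peel R S = begin
    ∑ (allSubsets n) (λ B → 𝟙 (R ⊆? B) * (𝟙 (independent? B ×-dec B ⊆? S) * (sgn B * acyclicOrientations (S ─ B))))
      ≡⟨ ∑-cong (allSubsets n) (λ B → trans
           (pull (𝟙 (R ⊆? B)) (𝟙 (independent? B ×-dec B ⊆? S)) (sgn B) (acyclicOrientations (S ─ B)))
           (trans (cong (_*_ (𝟙 (R ⊆? B) * sgn B)) (acyclicOrientations-sinks S B))
                  (sym (∑-*ˡ (allDigraphs n) (𝟙 (R ⊆? B) * sgn B) _)))) ⟩
    ∑ (allSubsets n) (λ B → ∑ (allDigraphs n) (λ D → 𝟙 (R ⊆? B) * sgn B * (𝟙 (orients? S D) * 𝟙 (B ⊆? sinks S D))))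
      ≡⟨ ∑-swap (allSubsets n) (allDigraphs n) _ ⟩
    ∑ (allDigraphs n) (λ D → ∑ (allSubsets n) (λ B → 𝟙 (R ⊆? B) * sgn B * (𝟙 (orients? S D) * 𝟙 (B ⊆? sinks S D))))
      ≡⟨ ∑-cong (allDigraphs n) (λ D → trans
           (∑-cong (allSubsets n) (λ B → rearrange (𝟙 (R ⊆? B)) (sgn B) (𝟙 (orients? S D)) (𝟙 (B ⊆? sinks S D))))
           (trans (∑-*ˡ (allSubsets n) (𝟙 (orients? S D)) _)
             (trans (cong (_*_ (𝟙 (orients? S D))) (∑-interval R (sinks S D)))
               (trans (front (𝟙 (orients? S D)) (𝟙 (R ≟ₛ sinks S D)) (sgn R))
                 (cong (_*_ (sgn R)) (sym (𝟙-× (orients? S D) (R ≟ₛ sinks S D)))))))) ⟩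
    ∑ (allDigraphs n) (λ D → sgn R * 𝟙 (orients? S D ×-dec R ≟ₛ sinks S D))
      ≡⟨ ∑-*ˡ (allDigraphs n) (sgn R) _ ⟩
    sgn R * ∑ (allDigraphs n) (λ D → 𝟙 (orients? S D ×-dec R ≟ₛ sinks S D)) ∎
    where
    pull : ∀ r b s a → r * (b * (s * a)) ≡ r * s * (b * a)
    pull = solve-∀
    rearrange : ∀ r s o b → r * s * (o * b) ≡ o * (r * (b * s))
    rearrange = solve-∀
    front : ∀ o e s → o * (e * s) ≡ s * (o * e)
    front = solve-∀

-- The Greene-Zaslavsky formula for orientations with a unique sink.

module GreeneZaslavsky {n} (G : Graph n) where
  open Graph G
  open Orientations G
  open Tilings independent?

  signedOrientations : Subset n → ℤ
  signedOrientations S = sgn S * acyclicOrientations S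

  -- Signs square to 1, so `sgn-─` can be solved for `sgn (S ─ B)`. This produces the factor `sgn B`
  -- that `∑-peel` expects.
  signedOrientations-─ : ∀ S B → B ⊆ S →
    signedOrientations (S ─ B) ≡ sgn S * (sgn B * acyclicOrientations (S ─ B))
  signedOrientations-─ S B B⊆S = begin
    sgn (S ─ B) * a                     ≡⟨ cong (_* a) (ℤ.*-identityˡ (sgn (S ─ B))) ⟨
    1ℤ * sgn (S ─ B) * a                ≡⟨ cong (λ z → z * sgn (S ─ B) * a) (sgn-sgn B) ⟨
    sgn B * sgn B * sgn (S ─ B) * a     ≡⟨ rearrange (sgn B) (sgn (S ─ B)) a ⟩
    sgn B * sgn (S ─ B) * (sgn B * a)   ≡⟨ cong (_* (sgn B * a)) (sgn-─ B S B⊆S) ⟨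
    sgn S * (sgn B * a)                 ∎
    where
    a : ℤ
    a = acyclicOrientations (S ─ B)
    rearrange : ∀ b c a → b * b * c * a ≡ b * c * (b * a)
    rearrange = solve-∀

  acyclicOrientations-empty : ∀ {S} → Empty S → acyclicOrientations S ≡ 1ℤ
  acyclicOrientations-empty {S} S∅ = begin
    ∑ (allDigraphs n) (λ D → 𝟙 (orients? S D))
      ≡⟨ ∑-cong (allDigraphs n) (λ D → trans
           (𝟙-cong (orients? S D) (D ≟ᴰ arcless) (mk⇔ (orients⇒arcless D) λ { refl → arcless-orients }))
           (sym (ℤ.*-identityʳ _))) ⟩
    ∑ (allDigraphs n) (λ D → 𝟙 (D ≟ᴰ arcless) * 1ℤ)
      ≡⟨ allDigraphs-enumerates n arcless (λ _ → 1ℤ) ⟩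
    1ℤ ∎
    where
    never? : Decidable₂ {A = Fin n} {B = Fin n} (λ _ _ → Data.Empty.⊥)
    never? _ _ = no λ ()

    arcless : Digraph n
    arcless = digraph never?

    orients⇒arcless : ∀ D → Orients S D → D ≡ arcless
    orients⇒arcless D orients = digraph-ext λ i j → mk⇔
      (λ i→j → contradiction (i , proj₁ (arc-within S D orients i→j)) S∅)
      (λ i→j → ⊥-elim (to (arc-digraph never?) i→j))

    arcless-orients : Orients S arcless
    arcless-orients =
      (λ i j → (λ i→j → ⊥-elim (to (arc-digraph never?) i→j)) ,
               (λ (_ , i∈S , _) → contradiction (i , i∈S) S∅)) ,
      λ i → no-walk
      where
      no-walk : ∀ {i j} → ¬ TransClosure (Arc arcless) i j
      no-walk Plus.[ i→j ]   = to (arc-digraph never?) i→j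
      no-walk (i→k Plus.∷ _) = to (arc-digraph never?) i→k

  -- Arcs never leave S, so following them from a vertex of S reaches a sink inside S; for empty S
  -- the arcless digraph is the only term.
  sinkless-orientations : ∀ S →
    ∑ (allDigraphs n) (λ D → 𝟙 (orients? S D ×-dec ⊥ ≟ₛ sinks S D)) ≡ 𝟙 (¬? (nonempty? S))
  sinkless-orientations S = by-cases (nonempty? S)
    where
    by-cases : Dec (Nonempty S) →
      ∑ (allDigraphs n) (λ D → 𝟙 (orients? S D ×-dec ⊥ ≟ₛ sinks S D)) ≡ 𝟙 (¬? (nonempty? S))
    by-cases (yes S≢∅@(i , i∈S)) = trans
      (∑-zero (allDigraphs n) (λ D → 𝟙-no (orients? S D ×-dec ⊥ ≟ₛ sinks S D) (has-sink D)))
      (sym (𝟙-no (¬? (nonempty? S)) (λ S∅ → S∅ S≢∅)))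
      where
      has-sink : ∀ D → ¬ (Orients S D × ⊥ ≡ sinks S D)
      has-sink D (orients , ⊥≡sinks)
        with v , v∈S , sink ← acyclic⇒sink D (proj₂ orients) {_∈ S}
                                (λ _ i→j → proj₂ (arc-within S D orients i→j)) i∈S =
        ∉⊥ (subst (v ∈_) (sym ⊥≡sinks) (from (∈-sinks S D) (v∈S , sink)))
    by-cases (no S∅) = begin
      ∑ (allDigraphs n) (λ D → 𝟙 (orients? S D ×-dec ⊥ ≟ₛ sinks S D))
        ≡⟨ ∑-cong (allDigraphs n) (λ D → 𝟙-cong (orients? S D ×-dec ⊥ ≟ₛ sinks S D) (orients? S D)
             (mk⇔ proj₁ λ orients → orients ,
               sym (Empty-unique λ (i , i∈) → S∅ (i , proj₁ (to (∈-sinks S D) i∈))))) ⟩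
      acyclicOrientations S
        ≡⟨ acyclicOrientations-empty S∅ ⟩
      1ℤ
        ≡⟨ 𝟙-yes (¬? (nonempty? S)) S∅ ⟨
      𝟙 (¬? (nonempty? S)) ∎

  -- This is `∑-peel` with R = ⊥: what survives the cancellation are the orientations without sinks
  -- in S.
  ∑-signedOrientations : ∀ S →
    ∑ (allSubsets n) (λ B → 𝟙 (independent? B ×-dec B ⊆? S) * signedOrientations (S ─ B)) ≡
    𝟙 (¬? (nonempty? S))
  ∑-signedOrientations S = begin
    ∑ (allSubsets n) (λ B → 𝟙 (independent? B ×-dec B ⊆? S) * signedOrientations (S ─ B))
      ≡⟨ ∑-cong (allSubsets n) (λ B → trans
           (𝟙-*-cong (independent? B ×-dec B ⊆? S) (λ (_ , B⊆S) → signedOrientations-─ S B B⊆S))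
           (trans (front (𝟙 (independent? B ×-dec B ⊆? S)) (sgn S) _)
             (cong (_*_ (sgn S)) (sym (𝟙-yes-* (⊥ ⊆? B) ⊥⊆))))) ⟩
    ∑ (allSubsets n) (λ B → sgn S * (𝟙 (⊥ ⊆? B) * (𝟙 (independent? B ×-dec B ⊆? S) *
      (sgn B * acyclicOrientations (S ─ B)))))
      ≡⟨ ∑-*ˡ (allSubsets n) (sgn S) _ ⟩
    sgn S * ∑ (allSubsets n) (λ B → 𝟙 (⊥ ⊆? B) * (𝟙 (independent? B ×-dec B ⊆? S) *
      (sgn B * acyclicOrientations (S ─ B))))
      ≡⟨ cong (_*_ (sgn S)) (∑-peel ⊥ S) ⟩
    sgn S * (sgn (⊥ {n}) * ∑ (allDigraphs n) (λ D → 𝟙 (orients? S D ×-dec ⊥ ≟ₛ sinks S D)))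
      ≡⟨ cong₂ (λ y z → sgn S * (y * z)) (sgn-⊥ n) (sinkless-orientations S) ⟩
    sgn S * (1ℤ * 𝟙 (¬? (nonempty? S)))
      ≡⟨ rearrange (sgn S) (𝟙 (¬? (nonempty? S))) ⟩
    𝟙 (¬? (nonempty? S)) * sgn S
      -- The leftover `sgn S` only matters where S is empty, and there it is 1.
      ≡⟨ 𝟙-*-cong (¬? (nonempty? S)) (λ S∅ → trans (cong sgn (Empty-unique S∅)) (sgn-⊥ n)) ⟩
    𝟙 (¬? (nonempty? S)) * 1ℤ
      ≡⟨ ℤ.*-identityʳ _ ⟩
    𝟙 (¬? (nonempty? S)) ∎
    where
    front : ∀ a b c → a * (b * c) ≡ b * (a * c)
    front = solve-∀
    rearrange : ∀ s e → s * (1ℤ * e) ≡ e * s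
    rearrange = solve-∀

  -- The empty set is independent but is not a block, so it has to be separated before the sum can
  -- be compared with one over fitting blocks.
  independent-split : ∀ S B → 𝟙 (independent? B ×-dec B ⊆? S) ≡ 𝟙 (fits? S B) + 𝟙 (B ≟ₛ ⊥)
  independent-split S B = by-cases (nonempty? B)
    where
    by-cases : Dec (Nonempty B) → 𝟙 (independent? B ×-dec B ⊆? S) ≡ 𝟙 (fits? S B) + 𝟙 (B ≟ₛ ⊥)
    by-cases (yes B≢∅@(_ , i∈B)) = begin
      𝟙 (independent? B ×-dec B ⊆? S)
        ≡⟨ 𝟙-cong (independent? B ×-dec B ⊆? S) (fits? S B)
             (mk⇔ (λ (ok , B⊆S) → (B≢∅ , ok) , λ {_} → B⊆S) (λ ((_ , ok) , B⊆S) → ok , λ {_} → B⊆S)) ⟩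
      𝟙 (fits? S B)
        ≡⟨ ℤ.+-identityʳ _ ⟨
      𝟙 (fits? S B) + 0ℤ
        ≡⟨ cong (_+_ (𝟙 (fits? S B))) (𝟙-no (B ≟ₛ ⊥) (λ { refl → ∉⊥ i∈B })) ⟨
      𝟙 (fits? S B) + 𝟙 (B ≟ₛ ⊥) ∎
    by-cases (no B∅) = trans
      (𝟙-yes (independent? B ×-dec B ⊆? S)
        ((λ i j i∈B _ _ → B∅ (i , i∈B)) , λ i∈B → contradiction (_ , i∈B) B∅))
      (sym (cong₂ _+_ (𝟙-no (fits? S B) (λ ((B≢∅ , _) , _) → B∅ B≢∅))
                      (𝟙-yes (B ≟ₛ ⊥) (Empty-unique B∅))))

  -- In `∑-signedOrientations` the term B = ⊥ is the value at S itself; moving the other terms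
  -- across gives the recursion of `orderedTilings-rec`.
  signedOrientations-rec : ∀ S → signedOrientations S ≡ 𝟙 (¬? (nonempty? S)) +
    -1ℤ * ∑ (allSubsets n) (λ B → 𝟙 (fits? S B) * signedOrientations (S ─ B))
  signedOrientations-rec S = begin
    signedOrientations S
      ≡⟨ isolate fitting (signedOrientations S) ⟩
    fitting + signedOrientations S + -1ℤ * fitting
      ≡⟨ cong (λ z → fitting + z + -1ℤ * fitting) (trans
           (allSubsets-enumerates n ⊥ (λ B → signedOrientations (S ─ B)))
           (cong signedOrientations (p─⊥≡p S))) ⟨
    fitting + ∑ (allSubsets n) (λ B → 𝟙 (B ≟ₛ ⊥) * signedOrientations (S ─ B)) + -1ℤ * fitting
      ≡⟨ cong (_+ -1ℤ * fitting) (trans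
           (sym (∑-+ (allSubsets n) _ _))
           (∑-cong (allSubsets n) (λ B → trans
             (sym (ℤ.*-distribʳ-+ (signedOrientations (S ─ B)) (𝟙 (fits? S B)) (𝟙 (B ≟ₛ ⊥))))
             (cong (_* signedOrientations (S ─ B)) (sym (independent-split S B)))))) ⟩
    ∑ (allSubsets n) (λ B → 𝟙 (independent? B ×-dec B ⊆? S) * signedOrientations (S ─ B)) + -1ℤ * fitting
      ≡⟨ cong (_+ -1ℤ * fitting) (∑-signedOrientations S) ⟩
    𝟙 (¬? (nonempty? S)) + -1ℤ * fitting ∎
    where
    fitting : ℤ
    fitting = ∑ (allSubsets n) (λ B → 𝟙 (fits? S B) * signedOrientations (S ─ B))
    isolate : ∀ a b → b ≡ a + b + -1ℤ * a
    isolate = solve-∀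

  signedOrientations-tilings : ∀ S →
    signedOrientations S ≡ tilingSum (allSubsets n) S (linearOrders ∘ length)
  signedOrientations-tilings =
    orderedTilings-unique independent? (allSubsets n) signedOrientations signedOrientations-rec

  uniqueSinkOrientations : Fin n → ℕ
  uniqueSinkOrientations v = length (filter (acyclicOrientationWithUniqueSink? G v) (allDigraphs n))

  -- Brings the condition into the form counted by `∑-peel` with R = ⁅ v ⁆ and S = ⊤.
  uniqueSink-⇔ : ∀ v D →
    (Orients ⊤ D × ⁅ v ⁆ ≡ sinks ⊤ D) ⇔ AcyclicOrientationWithUniqueSink G v D
  uniqueSink-⇔ v D = mk⇔
    (λ ((orient , acyclic) , v≡sinks) →
      (λ i j → proj₁ ∘ proj₁ (orient i j) , λ e → proj₂ (orient i j) (e , ∈⊤ , ∈⊤)) ,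
      acyclic ,
      proj₂ (to (∈-sinks ⊤ D) (subst (v ∈_) v≡sinks (x∈⁅x⁆ v))) ,
      λ w sink → x∈⁅y⁆⇒x≡y v (subst (w ∈_) (sym v≡sinks) (from (∈-sinks ⊤ D) (∈⊤ , sink))))
    (λ (orient , acyclic , sink , unique) →
      ((λ i j → (λ i→j → proj₁ (orient i j) i→j , ∈⊤ , ∈⊤) , λ (e , _) → proj₂ (orient i j) e) , acyclic) ,
      ⊆-antisym
        (λ i∈ → from (∈-sinks ⊤ D) (∈⊤ , subst (Sink D) (sym (x∈⁅y⁆⇒x≡y v i∈)) sink))
        (λ {w} w∈ → subst (_∈ ⁅ v ⁆) (sym (unique w (proj₂ (to (∈-sinks ⊤ D) w∈)))) (x∈⁅x⁆ v)))

  -- Removing the block B of v leaves tilings weighted by `linearOrders`, that is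
  -- `signedOrientations (⊤ ─ B)`, and `∑-peel` at ⁅ v ⁆ keeps the orientations whose only sink is
  -- v. The two sign factors come from ⊤ and ⁅ v ⁆.
  tilingSum-cyclicOrders : ∀ v →
    tilingSum (allSubsets n) ⊤ (cyclicOrders ∘ length) ≡ -1ℤ ^ n * (-1ℤ * + uniqueSinkOrientations v)
  tilingSum-cyclicOrders v = begin
    tilingSum (allSubsets n) ⊤ (cyclicOrders ∘ length)
      ≡⟨ tilingSum-by-element cyclicOrders (allSubsets n) {v = v} ∈⊤ ⟩
    ∑ (allSubsets n) (λ B → 𝟙 (fits? ⊤ B) * (𝟙 (v ∈? B) * tilingSum (allSubsets n) (⊤ ─ B) (linearOrders ∘ length)))
      ≡⟨ ∑-cong (allSubsets n) per-block ⟩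
    ∑ (allSubsets n) (λ B → sgn (⊤ {n}) * (𝟙 (⁅ v ⁆ ⊆? B) * (𝟙 (independent? B ×-dec B ⊆? ⊤) *
      (sgn B * acyclicOrientations (⊤ ─ B)))))
      ≡⟨ ∑-*ˡ (allSubsets n) (sgn (⊤ {n})) _ ⟩
    sgn (⊤ {n}) * ∑ (allSubsets n) (λ B → 𝟙 (⁅ v ⁆ ⊆? B) * (𝟙 (independent? B ×-dec B ⊆? ⊤) *
      (sgn B * acyclicOrientations (⊤ ─ B))))
      ≡⟨ cong₂ _*_ (sgn-⊤ n) (∑-peel ⁅ v ⁆ ⊤) ⟩
    -1ℤ ^ n * (sgn ⁅ v ⁆ * ∑ (allDigraphs n) (λ D → 𝟙 (orients? ⊤ D ×-dec ⁅ v ⁆ ≟ₛ sinks ⊤ D)))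
      ≡⟨ cong₂ (λ y z → -1ℤ ^ n * (y * z)) (sgn-⁅⁆ v) (trans
           (∑-cong (allDigraphs n) (λ D → 𝟙-cong (orients? ⊤ D ×-dec ⁅ v ⁆ ≟ₛ sinks ⊤ D)
             (acyclicOrientationWithUniqueSink? G v D) (uniqueSink-⇔ v D)))
           (sym (length-filter-∑ (acyclicOrientationWithUniqueSink? G v) (allDigraphs n)))) ⟩
    -1ℤ ^ n * (-1ℤ * + uniqueSinkOrientations v) ∎
    where
    -- Containing v already makes B nonempty, so fitting reduces to independence.
    guards : ∀ B → 𝟙 (fits? ⊤ B) * 𝟙 (v ∈? B) ≡ 𝟙 (⁅ v ⁆ ⊆? B) * 𝟙 (independent? B ×-dec B ⊆? ⊤)
    guards B = begin
      𝟙 (fits? ⊤ B) * 𝟙 (v ∈? B)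
        ≡⟨ 𝟙-× (fits? ⊤ B) (v ∈? B) ⟨
      𝟙 (fits? ⊤ B ×-dec v ∈? B)
        ≡⟨ 𝟙-cong (fits? ⊤ B ×-dec v ∈? B) (⁅ v ⁆ ⊆? B ×-dec (independent? B ×-dec B ⊆? ⊤)) (mk⇔
             (λ (((_ , ok) , B⊆⊤) , v∈B) →
               (λ i∈ → subst (_∈ B) (sym (x∈⁅y⁆⇒x≡y v i∈)) v∈B) , ok , λ {_} → B⊆⊤)
             (λ (v⊆B , ok , B⊆⊤) → (((v , v⊆B (x∈⁅x⁆ v)) , ok) , λ {_} → B⊆⊤) , v⊆B (x∈⁅x⁆ v))) ⟩
      𝟙 (⁅ v ⁆ ⊆? B ×-dec (independent? B ×-dec B ⊆? ⊤))
        ≡⟨ 𝟙-× (⁅ v ⁆ ⊆? B) (independent? B ×-dec B ⊆? ⊤) ⟩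
      𝟙 (⁅ v ⁆ ⊆? B) * 𝟙 (independent? B ×-dec B ⊆? ⊤) ∎

    per-block : ∀ B →
      𝟙 (fits? ⊤ B) * (𝟙 (v ∈? B) * tilingSum (allSubsets n) (⊤ ─ B) (linearOrders ∘ length)) ≡
      sgn (⊤ {n}) * (𝟙 (⁅ v ⁆ ⊆? B) * (𝟙 (independent? B ×-dec B ⊆? ⊤) *
        (sgn B * acyclicOrientations (⊤ ─ B))))
    per-block B = begin
      𝟙 (fits? ⊤ B) * (𝟙 (v ∈? B) * tilingSum (allSubsets n) (⊤ ─ B) (linearOrders ∘ length))
        ≡⟨ ℤ.*-assoc (𝟙 (fits? ⊤ B)) (𝟙 (v ∈? B)) _ ⟨
      𝟙 (fits? ⊤ B) * 𝟙 (v ∈? B) * tilingSum (allSubsets n) (⊤ ─ B) (linearOrders ∘ length)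
        ≡⟨ cong₂ _*_ (guards B) (trans (sym (signedOrientations-tilings (⊤ ─ B)))
             (signedOrientations-─ ⊤ B ⊆⊤)) ⟩
      𝟙 (⁅ v ⁆ ⊆? B) * 𝟙 (independent? B ×-dec B ⊆? ⊤) * (sgn (⊤ {n}) * (sgn B * acyclicOrientations (⊤ ─ B)))
        ≡⟨ front (𝟙 (⁅ v ⁆ ⊆? B)) (𝟙 (independent? B ×-dec B ⊆? ⊤)) (sgn (⊤ {n})) _ ⟩
      sgn (⊤ {n}) * (𝟙 (⁅ v ⁆ ⊆? B) * (𝟙 (independent? B ×-dec B ⊆? ⊤) *
        (sgn B * acyclicOrientations (⊤ ─ B)))) ∎
      where
      front : ∀ a b s x → a * b * (s * x) ≡ s * (a * (b * x))
      front = solve-∀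

-- Set partitions as tilings of the full set.

⊆-⋃ : ∀ {B} {bs : List (Subset n)} → B ∈ˡ bs → B ⊆ ⋃ bs
⊆-⋃ {bs = A ∷ bs} (here refl) i∈B = x∈p∪q⁺ (inj₁ i∈B)
⊆-⋃ {bs = A ∷ bs} (there B∈)  i∈B = x∈p∪q⁺ (inj₂ (⊆-⋃ B∈ i∈B))

disjoint-unique : ∀ {bs : List (Subset n)} → AllPairs Disjoint bs →
  ∀ {A B i} → A ∈ˡ bs → B ∈ˡ bs → i ∈ A → i ∈ B → A ≡ B
disjoint-unique (d ∷ ds) (here refl) (here refl) i∈A i∈B = refl
disjoint-unique (d ∷ ds) (here refl) (there B∈)  i∈A i∈B =
  contradiction (_ , x∈p∩q⁺ (i∈A , i∈B)) (All.lookup d B∈)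
disjoint-unique (d ∷ ds) (there A∈)  (here refl) i∈A i∈B =
  contradiction (_ , x∈p∩q⁺ (i∈B , i∈A)) (All.lookup d A∈)
disjoint-unique (d ∷ ds) (there A∈)  (there B∈)  i∈A i∈B = disjoint-unique ds A∈ B∈ i∈A i∈B

-- By disjointness the block witnessing `SameBlock σ i j` is B itself; the irrelevant partition
-- proof is made usable by deciding it again.
sameBlock-∈ : ∀ (σ : SetPartition n) {B i j} → B ∈ˡ blocks σ → i ∈ B → SameBlock σ i j → j ∈ B
sameBlock-∈ (mkSetPartition bs π) {j = j} B∈ i∈B i∼j
  with _ , disjoint , _ ← recompute (isSetPartition? bs) π | A , A∈ , i∈A , j∈A ← ∈ˡ-find i∼j =
  subst (j ∈_) (disjoint-unique disjoint A∈ B∈ i∈A i∈B) j∈A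

module _ {n} {Ok : Subset n → Set} (ok? : Decidable Ok) where
  open Tilings ok?

  -- Generalises `IsSetPartition`, which is `Covers ⊤`, so that induction along the list can pass
  -- from S to `S ─ B`.
  Covers : Subset n → List (Subset n) → Set
  Covers S bs = All Nonempty bs × AllPairs Disjoint bs × ⋃ bs ≡ S

  tiles⇒covers : ∀ S bs → Tiles S bs → Covers S bs × All Ok bs
  tiles⇒covers S []       S∅ = ([] , [] , sym (Empty-unique S∅)) , []
  tiles⇒covers S (B ∷ bs) (((B≢∅ , ok) , B⊆S) , t)
    with (≢∅ , disjoint , ⋃≡S─B) , oks ← tiles⇒covers (S ─ B) bs t =
    (B≢∅ ∷ ≢∅ , All.tabulate B-disjoint ∷ disjoint , ⊆-antisym ⋃⊆S S⊆⋃) , ok ∷ oks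
    where
    ⋃⊆S─B : ⋃ bs ⊆ S ─ B
    ⋃⊆S─B {i} = subst (i ∈_) ⋃≡S─B

    B-disjoint : ∀ {A} → A ∈ˡ bs → Disjoint B A
    B-disjoint A∈ (i , i∈B∩A) with i∈B , i∈A ← x∈p∩q⁻ B _ i∈B∩A =
      proj₂ (x∈p─q⁻ S B (⋃⊆S─B (⊆-⋃ A∈ i∈A))) i∈B

    ⋃⊆S : ⋃ (B ∷ bs) ⊆ S
    ⋃⊆S i∈ with x∈p∪q⁻ B (⋃ bs) i∈
    ... | inj₁ i∈B = B⊆S i∈B
    ... | inj₂ i∈⋃ = proj₁ (x∈p─q⁻ S B (⋃⊆S─B i∈⋃))

    S⊆⋃ : S ⊆ ⋃ (B ∷ bs)
    S⊆⋃ {i} i∈S with i ∈? B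
    ... | yes i∈B = x∈p∪q⁺ (inj₁ i∈B)
    ... | no  i∉B = x∈p∪q⁺ (inj₂ (subst (i ∈_) (sym ⋃≡S─B) (x∈p∧x∉q⇒x∈p─q i∈S i∉B)))

  covers⇒tiles : ∀ S bs → Covers S bs → All Ok bs → Tiles S bs
  covers⇒tiles S []       (_ , _ , refl) [] (_ , i∈⊥) = ∉⊥ i∈⊥
  covers⇒tiles S (B ∷ bs) (B≢∅ ∷ ≢∅ , d ∷ disjoint , refl) (ok ∷ oks) =
    ((B≢∅ , ok) , λ i∈B → x∈p∪q⁺ (inj₁ i∈B)) ,
    covers⇒tiles (S ─ B) bs (≢∅ , disjoint , ⊆-antisym ⋃⊆S─B S─B⊆⋃) oks
    where
    ⋃⊆S─B : ⋃ bs ⊆ S ─ B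
    ⋃⊆S─B i∈⋃ with A , A∈ , i∈A ← ∈ˡ-find (∈⋃⁻ bs i∈⋃) =
      x∈p∧x∉q⇒x∈p─q (x∈p∪q⁺ (inj₂ i∈⋃)) λ i∈B → All.lookup d A∈ (_ , x∈p∩q⁺ (i∈B , i∈A))

    S─B⊆⋃ : S ─ B ⊆ ⋃ bs
    S─B⊆⋃ i∈ with i∈S , i∉B ← x∈p─q⁻ S B i∈ with x∈p∪q⁻ B (⋃ bs) i∈S
    ... | inj₁ i∈B = contradiction i∈B i∉B
    ... | inj₂ i∈⋃ = i∈⋃

  -- Transfers sums over `setPartitions` to tilings of ⊤, for any condition Q that can be tested
  -- block by block; lists that are not set partitions contribute 0 to both.
  ∑-setPartitions : ∀ {Q : SetPartition n → Set} (Q? : Decidable Q) Φ →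
    (∀ σ → Q σ ⇔ All Ok (blocks σ)) →
    ∑ (setPartitions n) (λ σ → 𝟙 (Q? σ) * Φ (blocks σ)) ≡ tilingSum (allSubsets n) ⊤ Φ
  ∑-setPartitions {Q} Q? Φ Q⇔Ok =
    trans (∑-mapMaybe toSetPartition (sublists (allSubsets n)) φ) (∑-cong (sublists (allSubsets n)) per-list)
    where
    φ : SetPartition n → ℤ
    φ σ = 𝟙 (Q? σ) * Φ (blocks σ)

    per-list : ∀ bs → maybe′ φ 0ℤ (toSetPartition bs) ≡ 𝟙 (tiles? ⊤ bs) * Φ bs
    per-list bs with isSetPartition? bs
    ... | yes π = cong (_* Φ bs) (𝟙-cong (Q? σ) (tiles? ⊤ bs) (mk⇔
            (λ Qσ → covers⇒tiles ⊤ bs π (to (Q⇔Ok σ) Qσ))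
            (λ t → from (Q⇔Ok σ) (proj₂ (tiles⇒covers ⊤ bs t)))))
      where
      σ : SetPartition n
      σ = mkSetPartition bs π
    ... | no ¬π = sym (𝟙-no-* (tiles? ⊤ bs) (λ t → ¬π (proj₁ (tiles⇒covers ⊤ bs t))))

-- The kernel of a word: its graph and its set partition.

module _ {n} (w : Vec ℕ n) where

  kernelGraph : Graph n
  kernelGraph = record
    { Edge        = λ i j → ¬ lookup w i ≡ lookup w j
    ; edge?       = λ i j → ¬? (lookup w i ℕ.≟ lookup w j)
    ; symmetric   = λ i≁j j∼i → i≁j (sym j∼i)
    ; irreflexive = λ i i≁i → i≁i refl
    }

  open Orientations kernelGraph using (Independent; independent?)
  open GreeneZaslavsky using (uniqueSinkOrientations)

  -- A set is independent in `kernelGraph` when all its positions carry one letter; decidable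
  -- equality of letters removes the double negation.
  pTuple-⇔ : ∀ σ → PTuple σ w ⇔ All Independent (blocks σ)
  pTuple-⇔ σ = mk⇔
    (λ p → All.tabulate λ B∈ i j i∈B j∈B i≁j → i≁j (p i j (∈ˡ-lose B∈ (i∈B , j∈B))))
    (λ ok i j i∼j → case ∈ˡ-find i∼j of λ (A , A∈ , i∈A , j∈A) →
      decidable-stable (lookup w i ℕ.≟ lookup w j) (All.lookup ok A∈ i j i∈A j∈A))

  -- For nonempty B: a full fibre of w, all positions of one letter. This is the blockwise form of
  -- `MTuple`.
  KernelClass : Subset n → Set
  KernelClass B = ∀ i j → i ∈ B → lookup w i ≡ lookup w j ⇔ j ∈ B

  kernelClass? : Decidable KernelClass
  kernelClass? B = Fin.all? λ i → Fin.all? λ j →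
    i ∈? B →-dec ((lookup w i ℕ.≟ lookup w j) ⇔-dec (j ∈? B))

  mTuple-⇔ : ∀ σ → MTuple σ w ⇔ All KernelClass (blocks σ)
  mTuple-⇔ σ = mk⇔
    (λ m → All.tabulate λ B∈ i j i∈B → mk⇔
      (λ i∼j → sameBlock-∈ σ B∈ i∈B (to (m i j) i∼j))
      (λ j∈B → from (m i j) (∈ˡ-lose B∈ (i∈B , j∈B))))
    (λ ok i j → case ∈ˡ-find (sameBlock-refl σ i) of λ (B , B∈ , i∈B , _) → mk⇔
      (λ i∼j → ∈ˡ-lose B∈ (i∈B , to (All.lookup ok B∈ i j i∈B) i∼j))
      (λ i∼j → from (All.lookup ok B∈ i j i∈B) (sameBlock-∈ σ B∈ i∈B i∼j)))

  kernelClass : Fin n → Subset n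
  kernelClass i = subset (λ j → lookup w i ℕ.≟ lookup w j)

  ∈-kernelClass : ∀ i {j} → j ∈ kernelClass i ⇔ lookup w i ≡ lookup w j
  ∈-kernelClass i = ∈-subset (λ j → lookup w i ℕ.≟ lookup w j)

  -- Exactly one σ has w as a monomial of `m σ`. The block of v can only be the fibre of v, and its
  -- removal leaves a smaller union of fibres (`Closed`), so by induction there is a single tiling.
  kernel-unique : ∑ (setPartitions n) (λ σ → 𝟙 (mTuple? σ w) * 1ℤ) ≡ 1ℤ
  kernel-unique = trans (∑-setPartitions kernelClass? (λ σ → mTuple? σ w) (λ _ → 1ℤ) mTuple-⇔)
    (go ⊤ (⊂-wellFounded ⊤) (λ _ _ _ _ → ∈⊤))
    where
    open Tilings kernelClass?

    Closed : Subset n → Set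
    Closed S = ∀ i j → i ∈ S → lookup w i ≡ lookup w j → j ∈ S

    go : ∀ S → Acc _⊂_ S → Closed S → tilingSum (allSubsets n) S (λ _ → 1ℤ) ≡ 1ℤ
    go S (acc rec) closed = by-cases (nonempty? S)
      where
      by-cases : Dec (Nonempty S) → tilingSum (allSubsets n) S (λ _ → 1ℤ) ≡ 1ℤ
      by-cases (no S∅) = tilingSum-empty (allSubsets n) (λ _ → 1ℤ) S∅
      by-cases (yes (v , v∈S)) = begin
        tilingSum (allSubsets n) S (λ _ → 1ℤ)
          ≡⟨ tilingSum-by-element (λ _ → 1ℤ) (allSubsets n) v∈S ⟩
        ∑ (allSubsets n) (λ B → 𝟙 (fits? S B) * (𝟙 (v ∈? B) * rest B))
          ≡⟨ ∑-cong (allSubsets n) (λ B → trans (sym (ℤ.*-assoc (𝟙 (fits? S B)) (𝟙 (v ∈? B)) (rest B)))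
               (cong (_* rest B) (trans (sym (𝟙-× (fits? S B) (v ∈? B)))
                 (𝟙-cong (fits? S B ×-dec v ∈? B) (B ≟ₛ C) (mk⇔ is-class λ { refl → class-fits }))))) ⟩
        ∑ (allSubsets n) (λ B → 𝟙 (B ≟ₛ C) * rest B)
          ≡⟨ allSubsets-enumerates n C rest ⟩
        rest C
          ≡⟨ go (S ─ C) (rec (p∩q≢∅⇒p─q⊂p S C (v , x∈p∩q⁺ (v∈S , v∈C)))) closed-─ ⟩
        1ℤ ∎
        where
        C : Subset n
        C = kernelClass v

        rest : Subset n → ℤ
        rest B = tilingSum (allSubsets n) (S ─ B) (λ _ → 1ℤ)

        v∈C : v ∈ C
        v∈C = from (∈-kernelClass v) refl

        is-class : ∀ {B} → Fits S B × v ∈ B → B ≡ C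
        is-class (((_ , ok) , _) , v∈B) = ⊆-antisym
          (λ {j} j∈B → from (∈-kernelClass v) (from (ok v j v∈B) j∈B))
          (λ {j} j∈C → to (ok v j v∈B) (to (∈-kernelClass v) j∈C))

        class-fits : Fits S C × v ∈ C
        class-fits = (((v , v∈C) , λ i j i∈C → mk⇔
            (λ i∼j → from (∈-kernelClass v) (trans (to (∈-kernelClass v) i∈C) i∼j))
            (λ j∈C → trans (sym (to (∈-kernelClass v) i∈C)) (to (∈-kernelClass v) j∈C))) ,
          λ {j} j∈C → closed v j v∈S (to (∈-kernelClass v) j∈C)) , v∈C

        closed-─ : Closed (S ─ C)
        closed-─ i j i∈ i∼j with i∈S , i∉C ← x∈p─q⁻ S C i∈ =
          x∈p∧x∉q⇒x∈p─q (closed i j i∈S i∼j)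
            (λ j∈C → i∉C (from (∈-kernelClass v) (trans (to (∈-kernelClass v) j∈C) (sym i∼j))))

  -- `MTuple σ w` says that `K σ` and `kernelGraph` have the same edges; acyclicity and the sink
  -- condition depend on the digraph alone.
  c-kernel : ∀ σ v → MTuple σ w → c σ v ≡ uniqueSinkOrientations kernelGraph v
  c-kernel σ v m = cong length (List.filter-≐
    (acyclicOrientationWithUniqueSink? (K σ) v) (acyclicOrientationWithUniqueSink? kernelGraph v)
    ( (λ (orient , rest) → (λ i j →
          (λ i→j i∼j → proj₁ (orient i j) i→j (to (m i j) i∼j)) ,
          (λ i≁j → proj₂ (orient i j) (i≁j ∘ from (m i j)))) , rest)
    , (λ (orient , rest) → (λ i j →
          (λ i→j i∼j → proj₁ (orient i j) i→j (from (m i j) i∼j)) ,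
          (λ i≁j → proj₂ (orient i j) (i≁j ∘ to (m i j)))) , rest))
    (allDigraphs n))

  ∑-pTuple : ∀ v → ∑ (setPartitions n) (λ σ → 𝟙 (pTuple? σ w) * cyclicOrders (length (blocks σ))) ≡
    -1ℤ ^ n * (-1ℤ * ∑ (setPartitions n) (λ σ → + c σ v * 𝟙 (mTuple? σ w)))
  ∑-pTuple v = begin
    ∑ (setPartitions n) (λ σ → 𝟙 (pTuple? σ w) * cyclicOrders (length (blocks σ)))
      ≡⟨ ∑-setPartitions independent? (λ σ → pTuple? σ w) (cyclicOrders ∘ length) pTuple-⇔ ⟩
    Tilings.tilingSum independent? (allSubsets n) ⊤ (cyclicOrders ∘ length)
      ≡⟨ GreeneZaslavsky.tilingSum-cyclicOrders kernelGraph v ⟩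
    -1ℤ ^ n * (-1ℤ * k)
      -- Multiplying by `kernel-unique` spreads the count k over all σ; wherever the indicator is
      -- nonzero, k equals `c σ v`.
      ≡⟨ cong (λ z → -1ℤ ^ n * (-1ℤ * z)) (begin
           k
             ≡⟨ ℤ.*-identityʳ k ⟨
           k * 1ℤ
             ≡⟨ cong (_*_ k) kernel-unique ⟨
           k * ∑ (setPartitions n) (λ σ → 𝟙 (mTuple? σ w) * 1ℤ)
             ≡⟨ ∑-*ˡ (setPartitions n) k _ ⟨
           ∑ (setPartitions n) (λ σ → k * (𝟙 (mTuple? σ w) * 1ℤ))
             ≡⟨ ∑-cong (setPartitions n) (λ σ → trans (rearrange k (𝟙 (mTuple? σ w)))
                  (trans (𝟙-*-cong (mTuple? σ w) (λ m → cong +_ (sym (c-kernel σ v m))))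
                         (ℤ.*-comm (𝟙 (mTuple? σ w)) (+ c σ v)))) ⟩
           ∑ (setPartitions n) (λ σ → + c σ v * 𝟙 (mTuple? σ w)) ∎) ⟩
    -1ℤ ^ n * (-1ℤ * ∑ (setPartitions n) (λ σ → + c σ v * 𝟙 (mTuple? σ w))) ∎
    where
    k : ℤ
    k = + uniqueSinkOrientations kernelGraph v
    rearrange : ∀ k e → k * (e * 1ℤ) ≡ e * k
    rearrange = solve-∀

-- Passage from integer to rational coefficients.

-- Goes through unnormalised rationals, where sums are given by the plain formula; `_/_` on ℚ
-- divides by a gcd and does not reduce for variable a and b.
/1-+ : ∀ a b → (a + b) / 1 ≡ a / 1 ℚ.+ b / 1
/1-+ a b = ℚ.toℚᵘ-injective (ℚᵘ.≃-trans (ℚ.toℚᵘ-fromℚᵘ (ℚᵘ.mkℚᵘ (a + b) 0))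
  (ℚᵘ.≃-trans (ℚᵘ.*≡* (expand a b))
    (ℚᵘ.≃-sym (ℚᵘ.≃-trans (ℚ.toℚᵘ-homo-+ (a / 1) (b / 1))
      (ℚᵘ.+-cong (ℚ.toℚᵘ-fromℚᵘ (ℚᵘ.mkℚᵘ a 0)) (ℚ.toℚᵘ-fromℚᵘ (ℚᵘ.mkℚᵘ b 0)))))))
  where
  expand : ∀ a b → (a + b) * 1ℤ ≡ (a * 1ℤ + b * 1ℤ) * 1ℤ
  expand = solve-∀

/1-* : ∀ a b → (a * b) / 1 ≡ (a / 1) ℚ.* (b / 1)
/1-* a b = ℚ.toℚᵘ-injective (ℚᵘ.≃-trans (ℚ.toℚᵘ-fromℚᵘ (ℚᵘ.mkℚᵘ (a * b) 0))
  (ℚᵘ.≃-sym (ℚᵘ.≃-trans (ℚ.toℚᵘ-homo-* (a / 1) (b / 1))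
    (ℚᵘ.*-cong (ℚ.toℚᵘ-fromℚᵘ (ℚᵘ.mkℚᵘ a 0)) (ℚ.toℚᵘ-fromℚᵘ (ℚᵘ.mkℚᵘ b 0))))))

sumOver-/1 : ∀ (xs : List A) (f : A → Series) (g : A → ℤ) w →
  (∀ a → f a w ≡ g a / 1) → sumOver xs f w ≡ ∑ xs g / 1
sumOver-/1 []       f g w f≗g = refl
sumOver-/1 (x ∷ xs) f g w f≗g =
  trans (cong₂ ℚ._+_ (f≗g x) (sumOver-/1 xs f g w f≗g)) (sym (/1-+ (g x) (∑ xs g)))

monomialSum-length : ∀ {P : Vec ℕ n → Set} (P? : Decidable P) w (|w|≡n : length w ≡ n) →
  monomialSum P? w ≡ 𝟙 (P? (cast |w|≡n (fromList w))) / 1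
monomialSum-length {n} P? w |w|≡n with length w ℕ.≟ n
... | no |w|≢n = contradiction |w|≡n |w|≢n
... | yes _ with does (P? (cast |w|≡n (fromList w)))
...   | true  = refl
...   | false = refl

monomialSum-≢length : ∀ {P : Vec ℕ n → Set} (P? : Decidable P) w → length w ≢ n →
  monomialSum P? w ≡ 0ℚ
monomialSum-≢length {n} P? w |w|≢n with length w ℕ.≟ n
... | yes |w|≡n = contradiction |w|≡n |w|≢n
... | no _      = refl

sumOver-zero : ∀ (xs : List A) (f : A → Series) w → (∀ a → f a w ≡ 0ℚ) → sumOver xs f w ≡ 0ℚ
sumOver-zero []       f w f≗0 = refl
sumOver-zero (x ∷ xs) f w f≗0 = cong₂ ℚ._+_ (f≗0 x) (sumOver-zero xs f w f≗0)

-- The coefficients of x at the one-block partition.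

≤⟦⟧ : ∀ (σ : SetPartition (suc n)) → σ ≤ ⟦ suc n ⟧
≤⟦⟧ σ = All.tabulate (λ _ → here ⊆⊤)

-- The product has the single factor of the block ⊤, which contains every block of σ, so k is the
-- total number of blocks.
u-⟦⟧ : ∀ (σ : SetPartition (suc n)) → u σ ⟦ suc n ⟧ ≡ cyclicOrders (length (blocks σ))
u-⟦⟧ σ = trans (ℤ.*-identityʳ _)
  (cong (cyclicOrders ∘ length) (List.filter-all (_⊆? ⊤) {blocks σ} (All.tabulate (λ _ → ⊆⊤))))

x-⟦⟧-coefficient : ∀ n v w (|w|≡n : length w ≡ suc n) →
  x ⟦ suc n ⟧ w ≡ ((-1ℤ ^ n / 1) · (∑[ σ ← setPartitions (suc n) ] (+ c σ v / 1) · m σ)) w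
x-⟦⟧-coefficient n v w |w|≡n = begin
  x ⟦ suc n ⟧ w
    ≡⟨ sumOver-/1 (filter (_≤? ⟦ suc n ⟧) Π) _ (λ σ → u σ ⟦ suc n ⟧ * 𝟙 (pTuple? σ i)) w (λ σ → trans
         (cong (ℚ._*_ (u σ ⟦ suc n ⟧ / 1)) (monomialSum-length (pTuple? σ) w |w|≡n))
         (sym (/1-* (u σ ⟦ suc n ⟧) (𝟙 (pTuple? σ i))))) ⟩
  ∑ (filter (_≤? ⟦ suc n ⟧) Π) (λ σ → u σ ⟦ suc n ⟧ * 𝟙 (pTuple? σ i)) / 1
    ≡⟨ cong (_/ 1) integers ⟩
  (-1ℤ ^ n * ∑ Π (λ σ → + c σ v * 𝟙 (mTuple? σ i))) / 1
    ≡⟨ /1-* (-1ℤ ^ n) _ ⟩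
  (-1ℤ ^ n / 1) ℚ.* (∑ Π (λ σ → + c σ v * 𝟙 (mTuple? σ i)) / 1)
    ≡⟨ cong (ℚ._*_ (-1ℤ ^ n / 1)) (sumOver-/1 Π _ (λ σ → + c σ v * 𝟙 (mTuple? σ i)) w (λ σ → trans
         (cong (ℚ._*_ (+ c σ v / 1)) (monomialSum-length (mTuple? σ) w |w|≡n))
         (sym (/1-* (+ c σ v) (𝟙 (mTuple? σ i)))))) ⟨
  (-1ℤ ^ n / 1) ℚ.* (∑[ σ ← Π ] (+ c σ v / 1) · m σ) w ∎
  where
  Π : List (SetPartition (suc n))
  Π = setPartitions (suc n)

  i : Vec ℕ (suc n)
  i = cast |w|≡n (fromList w)

  integers : ∑ (filter (_≤? ⟦ suc n ⟧) Π) (λ σ → u σ ⟦ suc n ⟧ * 𝟙 (pTuple? σ i)) ≡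
    -1ℤ ^ n * ∑ Π (λ σ → + c σ v * 𝟙 (mTuple? σ i))
  integers = begin
    ∑ (filter (_≤? ⟦ suc n ⟧) Π) (λ σ → u σ ⟦ suc n ⟧ * 𝟙 (pTuple? σ i))
      ≡⟨ ∑-filter (_≤? ⟦ suc n ⟧) Π _ ⟩
    ∑ Π (λ σ → 𝟙 (σ ≤? ⟦ suc n ⟧) * (u σ ⟦ suc n ⟧ * 𝟙 (pTuple? σ i)))
      ≡⟨ ∑-cong Π (λ σ → trans (𝟙-yes-* (σ ≤? ⟦ suc n ⟧) (≤⟦⟧ σ))
           (trans (cong (_* 𝟙 (pTuple? σ i)) (u-⟦⟧ σ)) (ℤ.*-comm _ (𝟙 (pTuple? σ i))))) ⟩
    ∑ Π (λ σ → 𝟙 (pTuple? σ i) * cyclicOrders (length (blocks σ)))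
      ≡⟨ ∑-pTuple i v ⟩
    -1ℤ ^ suc n * (-1ℤ * ∑ Π (λ σ → + c σ v * 𝟙 (mTuple? σ i)))
      -- The degree is `suc n`: its sign and the extra -1 combine to (-1)^n, the exponent being the
      -- degree minus one.
      ≡⟨ cancel (-1ℤ ^ n) _ ⟩
    -1ℤ ^ n * ∑ Π (λ σ → + c σ v * 𝟙 (mTuple? σ i)) ∎
    where
    cancel : ∀ s k → -1ℤ * s * (-1ℤ * k) ≡ s * k
    cancel = solve-∀

-- Both series are homogeneous of degree `suc n`, so words of any other length have coefficient 0 in
-- each.
x-⟦⟧ : ∀ n v →
  x ⟦ suc n ⟧ ≋ (-1ℤ ^ n / 1) · (∑[ σ ← setPartitions (suc n) ] (+ c σ v / 1) · m σ)
x-⟦⟧ n v w = by-cases (length w ℕ.≟ suc n)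
  where
  by-cases : Dec (length w ≡ suc n) →
    x ⟦ suc n ⟧ w ≡ ((-1ℤ ^ n / 1) · (∑[ σ ← setPartitions (suc n) ] (+ c σ v / 1) · m σ)) w
  by-cases (yes |w|≡n) = x-⟦⟧-coefficient n v w |w|≡n
  by-cases (no |w|≢n)  = trans
    (sumOver-zero (filter (_≤? ⟦ suc n ⟧) (setPartitions (suc n))) _ w (λ σ → trans
      (cong (ℚ._*_ (u σ ⟦ suc n ⟧ / 1)) (monomialSum-≢length (pTuple? σ) w |w|≢n))
      (ℚ.*-zeroʳ (u σ ⟦ suc n ⟧ / 1))))
    (sym (trans
      (cong (ℚ._*_ (-1ℤ ^ n / 1)) (sumOver-zero (setPartitions (suc n)) _ w (λ σ → trans
        (cong (ℚ._*_ (+ c σ v / 1)) (monomialSum-≢length (mTuple? σ) w |w|≢n))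
        (ℚ.*-zeroʳ (+ c σ v / 1)))))
      (ℚ.*-zeroʳ (-1ℤ ^ n / 1))))

-- Independence of the chosen sink, and the theorem.

-- Applies `tilingSum-cyclicOrders` to `K σ` itself: the tiling sum does not mention the sink, and
-- the sign in front of the count is invertible because it squares to 1.
c-independent : ∀ (σ : SetPartition n) v w → c σ v ≡ c σ w
c-independent {n} σ v w = ℤ.+-injective (begin
  + c σ v                                        ≡⟨ recover (+ c σ v) ⟩
  - sgn ⊤ₙ * (sgn ⊤ₙ * (-1ℤ * + c σ v))          ≡⟨ cong (_*_ (- sgn ⊤ₙ)) same ⟩
  - sgn ⊤ₙ * (sgn ⊤ₙ * (-1ℤ * + c σ w))          ≡⟨ recover (+ c σ w) ⟨
  + c σ w                                        ∎)
  where
  ⊤ₙ : Subset n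
  ⊤ₙ = ⊤

  same : sgn ⊤ₙ * (-1ℤ * + c σ v) ≡ sgn ⊤ₙ * (-1ℤ * + c σ w)
  same = trans (tilingSum-c v) (sym (tilingSum-c w))
    where
    tilingSum-c : ∀ v → sgn ⊤ₙ * (-1ℤ * + c σ v) ≡
      Tilings.tilingSum (Orientations.independent? (K σ)) (allSubsets n) ⊤ (cyclicOrders ∘ length)
    tilingSum-c v = trans (cong (_* (-1ℤ * + c σ v)) (sgn-⊤ n))
      (sym (GreeneZaslavsky.tilingSum-cyclicOrders (K σ) v))

  recover : ∀ k → k ≡ - sgn ⊤ₙ * (sgn ⊤ₙ * (-1ℤ * k))
  recover k = begin
    k                                ≡⟨ ℤ.*-identityˡ k ⟨
    1ℤ * k                           ≡⟨ cong (_* k) (sgn-sgn ⊤ₙ) ⟨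
    sgn ⊤ₙ * sgn ⊤ₙ * k              ≡⟨ rearrange (sgn ⊤ₙ) k ⟩
    - sgn ⊤ₙ * (sgn ⊤ₙ * (-1ℤ * k))  ∎
    where
    rearrange : ∀ s k → s * s * k ≡ - s * (s * (-1ℤ * k))
    rearrange = solve-∀

theorem4p1 : (n : ℕ) .{{_ : NonZero n}} →
    (∀ (σ : SetPartition n) (v w : Fin n) → c σ v ≡ c σ w) ×
    (∀ (v : Fin n) →
    x ⟦ n ⟧ ≋ (-1ℤ ^ (n ∸ 1) / 1) · (∑[ σ ← setPartitions n ] (+ c σ v / 1) · m σ))
theorem4p1 (suc n) = c-independent , x-⟦⟧ n
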